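{- For every $g\in\mathbb N^+$, $\mathit{Eng}_g\not\approx\widehat{\mathit{Eng}_g}$, where $\mathit{Eng}_g$ and $\widehat{\mathit{Eng}_g}$ are the engine CPSs defined in the context.
   Context: The calculus. Physical state $S=\langle\xi_x,\xi_s,\xi_a\rangle$; environment $E=\langle\mathit{evol},\mathit{meas},\mathit{inv}\rangle$ ($\mathit{evol}$: state and actuator functions $\to$ finite-support distribution on state functions; $\mathit{meas}$: state function $\to$ distribution on sensor functions; $\mathit{inv}$ a set of state functions); $\mathit{next}_E(S)=\sum_{\xi'_x,\xi'_s}\mathit{evol}(\xi_x,\xi_a)(\xi'_x)\mathit{meas}(\xi'_x)(\xi'_s)\overline{\langle\xi'_x,\xi'_s,\xi_a\rangle}$. Processes $P::=\mathsf{nil}\mid \mathsf{tick}.C\mid P\parallel Q\mid \lfloor \mathit{chn}.C\rfloor D\mid \mathit{phy}.C\mid \mathsf{if}\ b\ \mathsf{then}\ P\ \mathsf{else}\ Q\mid P\backslash c\mid X\mid \mathsf{fix}\,X.P$, $C::=\bigoplus_ip_i{:}P_i$, $\mathit{chn}::=c!v\mid c?(x)$, $\mathit{phy}::=\mathsf{read}\ s(x)\mid\mathsf{write}\ a\langle v\rangle$; time-guarded recursion; conditional = selected branch; $[\![\bigoplus_ip_i{:}P_i]\!]=\sum_ip_i\overline{P_i}$. Process transitions: $\lfloor c!v.C\rfloor D\xrightarrow{c!v}[\![C]\!]$; $\lfloor c?(x).C\rfloor D\xrightarrow{c?v}[\![C]\!]\{v/x\}$; $\mathsf{write}\ a\langle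 v\rangle.C\xrightarrow{a!v}[\![C]\!]$; $\mathsf{read}\ s(x).C\xrightarrow{s?x}[\![C]\!]$; $c!v$/$c?v$ synchronise to $\tau$ under $\parallel$; non-tick moves propagate through $\parallel$; moves other than $c!v,c?v$ through $\backslash c$; recursion unfolds; $\mathsf{nil}\xrightarrow{\mathsf{tick}}\overline{\mathsf{nil}}$; $\mathsf{tick}.C\xrightarrow{\mathsf{tick}}[\![C]\!]$; $\lfloor\mathit{chn}.C\rfloor D\xrightarrow{\mathsf{tick}}[\![D]\!]$; $P_1\parallel P_2\xrightarrow{\mathsf{tick}}\pi_1\parallel\pi_2$ if both tick and no $\tau$-move. CPS $E;S\rhd P$ rules: $P\xrightarrow{\alpha}\pi$, $\alpha\in\{c!v,c?v,\tau\}$, $S\in\mathit{inv}$ give $E;S\rhd P\xrightarrow{\alpha}E;\overline S\rhd\pi$; sensor read $s?z$ gives $\tau$ to $E;\overline S\rhd\pi\{\xi_s(s)/z\}$; actuator write $a!v$ gives $\tau$ to $E;\overline{\langle\xi_x,\xi_s,\xi_a[a\mapsto v]\rangle}\rhd\pi$ (if $S\in\mathit{inv}$); $P\xrightarrow{\mathsf{tick}}\pi$, no $\tau$-move, $S\in\mathit{inv}$ give $\xrightarrow{\mathsf{tick}}E;\mathit{next}_E(S)\rhd\pi$; $S\notin\mathit{inv}$ gives $\xrightarrow{\tau}\overline{\mathsf{Dead}}$ ($\mathsf{Dead}$ has no transitions). Weak bisimilarity: $M\xrightarrow{\hat\tau}\gamma$ iff $M\xrightarrow{\tau}\gamma$ or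 $\gamma=\overline M$; $\xrightarrow{\hat\alpha}=\xrightarrow{\alpha}$ for $\alpha\ne\tau$; for $\gamma=\sum_{i\in I}p_i\overline{M_i}$, $\gamma\xrightarrow{\hat\alpha}\sum_{j\in J}p_j\gamma_j$ where $J\ne\emptyset$ is the set of $i$ with a move $M_i\xrightarrow{\hat\alpha}\gamma_i$; $\stackrel{\hat\tau}{\Longrightarrow}$ reflexive-transitive closure; $\stackrel{\hat\alpha}{\Longrightarrow}=\stackrel{\hat\tau}{\Longrightarrow}\xrightarrow{\hat\alpha}\stackrel{\hat\tau}{\Longrightarrow}$ for $\alpha\ne\tau$. A matching of $(\gamma,\gamma')$ is a distribution on pairs with marginals $\gamma,\gamma'$. A symmetric relation $\mathcal R$ is a weak probabilistic bisimulation if $M\mathcal RN$, $M\xrightarrow{\alpha}\gamma$ imply $N\stackrel{\hat\alpha}{\Longrightarrow}\gamma'$ and a matching $\omega$ with $\omega(M',N')>0\Rightarrow M'\mathcal RN'$; $\approx$ is the union of all such relations. The engines. $[v,w]_g=\{k\in[v,w]:k=v+h\cdot10^{ -g},h\in\mathbb N\}$; $\delta=0.4$, $\mathit{err}=0.1$. State variable $\mathit{temp}$, sensor $s_t$, actuator $\mathit{cool}\in\{\mathsf{on},\mathsf{off}\}$. $S_g$: $\mathit{temp}=0$, $s_t=0$, $\mathit{cool}=\mathsf{off}$. $\mathit{Env}_g$: $\mathit{evol}(\xi_x,\xi_a)$ uniform over $[\mathit{temp}\mapsto\xi_x(\mathit{temp})+v]$, $v\in[v_1,v_2]_g$, with $[v_1,v_2]=[1-\delta,1+\delta]$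 if cooling $\mathsf{off}$, $[-1-\delta,-1+\delta]$ if $\mathsf{on}$; $\mathit{meas}(\xi_x)$ uniform over $[s_t\mapsto\xi_x(\mathit{temp})+v]$, $v\in[-\mathit{err},\mathit{err}]_g$; $\mathit{inv}=\{[\mathit{temp}\mapsto x]:0\le x\le30\}$. $\widehat{\mathit{Env}_g}$ is identical except that $[v_1,v_2]=[-0.7-\delta,-0.7+\delta]$ when cooling is $\mathsf{on}$. $\mathsf{tick}^k.P$ is $k$ nested ticks; $c!v.P$ abbreviates $\mathsf{fix}\,Z.\lfloor c!v.P\rfloor Z$. $\mathit{Ctrl}=\mathsf{fix}\,X.\mathsf{read}\ s_t(x).\mathsf{if}\ x>10\ \mathsf{then}\ \mathit{Cooling}\ \mathsf{else}\ \mathsf{tick}.X$, $\mathit{Cooling}=\mathsf{write}\ \mathit{cool}\langle\mathsf{on}\rangle.\mathsf{fix}\,Y.\mathsf{tick}^5.\mathsf{read}\ s_t(x).\mathsf{if}\ x>10\ \mathsf{then}\ \mathit{warning}!\mathrm{ID}.Y\ \mathsf{else}\ \mathsf{write}\ \mathit{cool}\langle\mathsf{off}\rangle.\mathsf{tick}.X$. $\mathit{Eng}_g=\mathit{Env}_g;S_g\rhd\mathit{Ctrl}$ and $\widehat{\mathit{Eng}_g}=\widehat{\mathit{Env}_g};S_g\rhd\mathit{Ctrl}$. -}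

module Defs where

open import Data.Nat as ℕ using (ℕ; zero; suc)
open import Data.Nat.Properties using (m^n≢0)
open import Data.Integer as ℤ using (ℤ; +_; ∣_∣)
open import Data.Rational using (ℚ; 0ℚ; 1ℚ; _+_; _-_; _*_; -_; _/_; _≤_; _<_; floor)
open import Data.Rational.Properties using (_≤?_; _<?_)
open import Data.Bool using (Bool; true; false; _∧_)
open import Data.Maybe using (Maybe; just; nothing)
open import Data.List using (List; []; _∷_; map; concatMap; _++_; length; upTo; foldr)
open import Data.List.Relation.Unary.All using (All)
open import Data.List.Relation.Unary.Unique.Propositional using (Unique)
open import Data.List.Membership.Propositional using (_∈_)
open import Data.Product using (Σ; _×_; _,_; proj₁; proj₂)
open import Relation.Nullary using (¬_; does)
open import Relation.Binary.PropositionalEquality using (_≡_; _≢_)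

-- Finite-support (sub)distributions, represented by formal weighted lists
-- Σ_i p_i · a_i.  Two such lists denote the same (sub)distribution iff
-- they give the same expectation to every function A → ℚ.

Dist : Set → Set
Dist A = List (ℚ × A)

dirac : {A : Set} → A → Dist A
dirac a = (1ℚ , a) ∷ []

dmap : {A B : Set} → (A → B) → Dist A → Dist B
dmap f = map (λ e → proj₁ e , f (proj₂ e))

scale : {A : Set} → ℚ → Dist A → Dist A
scale p = map (λ e → p * proj₁ e , proj₂ e)

dprod : {A B C : Set} → (A → B → C) → Dist A → Dist B → Dist C
dprod f γ δ = concatMap (λ e → map (λ e' → proj₁ e * proj₁ e' , f (proj₂ e) (proj₂ e')) δ) γ

expect : {A : Set} → Dist A → (A → ℚ) → ℚ
expect γ f = foldr (λ e r → proj₁ e * f (proj₂ e) + r) 0ℚ γ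

_≃_ : {A : Set} → Dist A → Dist A → Set
γ ≃ δ = ∀ f → expect γ f ≡ expect δ f

-- the list is the canonical decomposition Σ_{i∈I} p_i M_i of a distribution:
-- pairwise distinct points, all with positive probability
Canonical : {A : Set} → Dist A → Set
Canonical γ = Unique (map proj₂ γ) × All (λ e → 0ℚ < proj₁ e) γ

data Val : Set where
  num : ℚ → Val
  on off ID : Val

data Chan : Set where
  warning : Chan

data SName : Set where
  s-t : SName

data AName : Set where
  cool : AName

data Exp : Set where
  val : Val → Exp
  var : ℕ → Exp

data BExp : Set where
  gt : Exp → Exp → BExp

data ChnPref : Set where
  snd : Chan → Exp → ChnPref
  rcv : Chan → ℕ → ChnPref

data PhyPref : Set where
  rd : SName → ℕ → PhyPref
  wr : AName → Exp → PhyPref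

-- C ::= ⊕_i p_i : P_i  is represented as List (ℚ × Proc)
data Proc : Set where
  nil     : Proc
  tickP   : List (ℚ × Proc) → Proc
  _∥_     : Proc → Proc → Proc
  timeout : ChnPref → List (ℚ × Proc) → List (ℚ × Proc) → Proc
  phy     : PhyPref → List (ℚ × Proc) → Proc
  ite     : BExp → Proc → Proc → Proc
  restr   : Proc → Chan → Proc
  pvar    : ℕ → Proc
  fix     : ℕ → Proc → Proc

Choice : Set
Choice = List (ℚ × Proc)

⟦_⟧ : Choice → Dist Proc
⟦ C ⟧ = C

-- Substitutions (only closed values / closed processes are ever substituted)

substE : ℕ → Val → Exp → Exp
substE x v (val w) = val w
substE x v (var y) with x ℕ.≡ᵇ y
... | true = val v
... | false = var y

substB : ℕ → Val → BExp → BExp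
substB x v (gt e₁ e₂) = gt (substE x v e₁) (substE x v e₂)

mutual
  substV : ℕ → Val → Proc → Proc
  substV x v nil = nil
  substV x v (tickP C) = tickP (substVC x v C)
  substV x v (P ∥ Q) = substV x v P ∥ substV x v Q
  substV x v (timeout (snd c e) C D) = timeout (snd c (substE x v e)) (substVC x v C) (substVC x v D)
  substV x v (timeout (rcv c y) C D) with x ℕ.≡ᵇ y
  ... | true = timeout (rcv c y) C (substVC x v D)
  ... | false = timeout (rcv c y) (substVC x v C) (substVC x v D)
  substV x v (phy (wr a e) C) = phy (wr a (substE x v e)) (substVC x v C)
  substV x v (phy (rd s y) C) with x ℕ.≡ᵇ y
  ... | true = phy (rd s y) C
  ... | false = phy (rd s y) (substVC x v C)
  substV x v (ite b P Q) = ite (substB x v b) (substV x v P) (substV x v Q)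
  substV x v (restr P c) = restr (substV x v P) c
  substV x v (pvar X) = pvar X
  substV x v (fix X P) = fix X (substV x v P)

  substVC : ℕ → Val → Choice → Choice
  substVC x v [] = []
  substVC x v ((p , P) ∷ C) = (p , substV x v P) ∷ substVC x v C

mutual
  substP : ℕ → Proc → Proc → Proc
  substP X R nil = nil
  substP X R (tickP C) = tickP (substPC X R C)
  substP X R (P ∥ Q) = substP X R P ∥ substP X R Q
  substP X R (timeout π C D) = timeout π (substPC X R C) (substPC X R D)
  substP X R (phy π C) = phy π (substPC X R C)
  substP X R (ite b P Q) = ite b (substP X R P) (substP X R Q)
  substP X R (restr P c) = restr (substP X R P) c
  substP X R (pvar Y) with X ℕ.≡ᵇ Y
  ... | true = R
  ... | false = pvar Y
  substP X R (fix Y P) with X ℕ.≡ᵇ Y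
  ... | true = fix Y P
  ... | false = fix Y (substP X R P)

  substPC : ℕ → Proc → Choice → Choice
  substPC X R [] = []
  substPC X R ((p , P) ∷ C) = (p , substP X R P) ∷ substPC X R C

evalB : BExp → Maybe Bool
evalB (gt (val (num a)) (val (num b))) = just (does (b <? a))
evalB _ = nothing

data PLab : Set where
  pout : Chan → Val → PLab
  pin  : Chan → Val → PLab
  pτ   : PLab
  pwr  : AName → Val → PLab
  prd  : SName → ℕ → PLab

NotOn : Chan → PLab → Set
NotOn c (pout d v) = d ≢ c
NotOn c (pin d v) = d ≢ c
NotOn c _ = Data.Unit.⊤
  where import Data.Unit

data _—[_]→_ : Proc → PLab → Dist Proc → Set where
  out   : ∀ {c v C D} → timeout (snd c (val v)) C D —[ pout c v ]→ ⟦ C ⟧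
  inp   : ∀ {c x v C D} → timeout (rcv c x) C D —[ pin c v ]→ dmap (substV x v) ⟦ C ⟧
  write : ∀ {a v C} → phy (wr a (val v)) C —[ pwr a v ]→ ⟦ C ⟧
  read  : ∀ {s x C} → phy (rd s x) C —[ prd s x ]→ ⟦ C ⟧
  syncL : ∀ {P Q c v π₁ π₂} → P —[ pout c v ]→ π₁ → Q —[ pin c v ]→ π₂ →
          (P ∥ Q) —[ pτ ]→ dprod _∥_ π₁ π₂
  syncR : ∀ {P Q c v π₁ π₂} → P —[ pin c v ]→ π₁ → Q —[ pout c v ]→ π₂ →
          (P ∥ Q) —[ pτ ]→ dprod _∥_ π₁ π₂
  parL  : ∀ {P Q α π} → P —[ α ]→ π → (P ∥ Q) —[ α ]→ dmap (λ R → R ∥ Q) π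
  parR  : ∀ {P Q α π} → Q —[ α ]→ π → (P ∥ Q) —[ α ]→ dmap (λ R → P ∥ R) π
  res   : ∀ {P c α π} → NotOn c α → P —[ α ]→ π → restr P c —[ α ]→ dmap (λ R → restr R c) π
  rec   : ∀ {X P α π} → substP X (fix X P) P —[ α ]→ π → fix X P —[ α ]→ π
  ifT   : ∀ {b P Q α π} → evalB b ≡ just true → P —[ α ]→ π → ite b P Q —[ α ]→ π
  ifF   : ∀ {b P Q α π} → evalB b ≡ just false → Q —[ α ]→ π → ite b P Q —[ α ]→ π

data _—tick→_ : Proc → Dist Proc → Set where
  tnil  : nil —tick→ dirac nil
  ttick : ∀ {C} → tickP C —tick→ ⟦ C ⟧
  ttime : ∀ {π C D} → timeout π C D —tick→ ⟦ D ⟧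
  tpar  : ∀ {P Q π₁ π₂} → P —tick→ π₁ → Q —tick→ π₂ →
          ¬ (Σ (Dist Proc) λ π → (P ∥ Q) —[ pτ ]→ π) →
          (P ∥ Q) —tick→ dprod _∥_ π₁ π₂
  tres  : ∀ {P c π} → P —tick→ π → restr P c —tick→ dmap (λ R → restr R c) π
  trec  : ∀ {X P π} → substP X (fix X P) P —tick→ π → fix X P —tick→ π
  tifT  : ∀ {b P Q π} → evalB b ≡ just true → P —tick→ π → ite b P Q —tick→ π
  tifF  : ∀ {b P Q π} → evalB b ≡ just false → Q —tick→ π → ite b P Q —tick→ π

-- Physical states and environments
-- (single state variable temp, single sensor s_t, single actuator cool,
--  so state functions are represented by their unique value)

record PState : Set where
  constructor ⟨_,_,_⟩
  field
    temp : ℚ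
    sens : ℚ
    act  : Val
open PState public

record Env : Set where
  field
    evol : ℚ → Val → Dist ℚ
    meas : ℚ → Dist ℚ
    inv  : ℚ → Bool
open Env public

next : Env → PState → Dist PState
next E S = concatMap (λ e → map (λ e' → proj₁ e * proj₁ e' , ⟨ proj₂ e , proj₂ e' , act S ⟩)
                                (meas E (proj₂ e)))
                     (evol E (temp S) (act S))

data Sys : Set where
  cps  : Env → PState → Proc → Sys
  Dead : Sys

data Lab : Set where
  out  : Chan → Val → Lab
  inp  : Chan → Val → Lab
  τ    : Lab
  tick : Lab

data _==[_]⇒_ : Sys → Lab → Dist Sys → Set where
  cOut  : ∀ {E S P c v π} → inv E (temp S) ≡ true → P —[ pout c v ]→ π →
          cps E S P ==[ out c v ]⇒ dmap (cps E S) π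
  cIn   : ∀ {E S P c v π} → inv E (temp S) ≡ true → P —[ pin c v ]→ π →
          cps E S P ==[ inp c v ]⇒ dmap (cps E S) π
  cTau  : ∀ {E S P π} → inv E (temp S) ≡ true → P —[ pτ ]→ π →
          cps E S P ==[ τ ]⇒ dmap (cps E S) π
  cRead : ∀ {E S P s z π} → inv E (temp S) ≡ true → P —[ prd s z ]→ π →
          cps E S P ==[ τ ]⇒ dmap (λ R → cps E S (substV z (num (sens S)) R)) π
  cWrite : ∀ {E S P a v π} → inv E (temp S) ≡ true → P —[ pwr a v ]→ π →
          cps E S P ==[ τ ]⇒ dmap (cps E ⟨ temp S , sens S , v ⟩) π
  cTime : ∀ {E S P π} → inv E (temp S) ≡ true → P —tick→ π →
          ¬ (Σ (Dist Proc) λ π' → P —[ pτ ]→ π') →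
          cps E S P ==[ tick ]⇒ dprod (cps E) (next E S) π
  cDead : ∀ {E S P} → inv E (temp S) ≡ false → cps E S P ==[ τ ]⇒ dirac Dead

data HatStep : Sys → Lab → Dist Sys → Set where
  real : ∀ {M α γ} → M ==[ α ]⇒ γ → HatStep M α γ
  idle : ∀ {M} → HatStep M τ (dirac M)

-- lifting along a list Σ_i p_i M_i; the Bool records whether J ≠ ∅
data LiftStep (α : Lab) : Dist Sys → Dist Sys → Bool → Set where
  lnil   : LiftStep α [] [] false
  lmove  : ∀ {p M γ δ ρ b} → HatStep M α δ → LiftStep α γ ρ b →
           LiftStep α ((p , M) ∷ γ) (scale p δ ++ ρ) true
  lstuck : ∀ {p M γ ρ b} → ¬ (Σ (Dist Sys) λ δ → HatStep M α δ) → LiftStep α γ ρ b →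
           LiftStep α ((p , M) ∷ γ) ρ b

-- γ —α̂→ δ for distributions (decomposition = canonical one)
DStep : Dist Sys → Lab → Dist Sys → Set
DStep γ α δ = Σ (Dist Sys) λ γ₀ → Canonical γ₀ × γ₀ ≃ γ × LiftStep α γ₀ δ true

data TauStar : Dist Sys → Dist Sys → Set where
  refl* : ∀ {γ} → TauStar γ γ
  step* : ∀ {γ δ ρ} → DStep γ τ δ → TauStar δ ρ → TauStar γ ρ

Weak : Sys → Lab → Dist Sys → Set
Weak N τ γ = TauStar (dirac N) γ
Weak N α γ = Σ (Dist Sys) λ γ₁ → Σ (Dist Sys) λ γ₂ →
             TauStar (dirac N) γ₁ × DStep γ₁ α γ₂ × TauStar γ₂ γ

Matching : Dist (Sys × Sys) → Dist Sys → Dist Sys → Set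
Matching ω γ γ' = All (λ e → 0ℚ ≤ proj₁ e) ω
                × dmap proj₁ ω ≃ γ × dmap proj₂ ω ≃ γ'

IsWeakBisim : (Sys → Sys → Set) → Set
IsWeakBisim R =
  (∀ {M N} → R M N → R N M) ×
  (∀ {M N α γ} → R M N → M ==[ α ]⇒ γ →
     Σ (Dist Sys) λ γ' → Weak N α γ' ×
     Σ (Dist (Sys × Sys)) λ ω → Matching ω γ γ' ×
       (∀ {p M' N'} → (p , (M' , N')) ∈ ω → 0ℚ < p → R M' N'))

_≈_ : Sys → Sys → Set₁
M ≈ N = Σ (Sys → Sys → Set) λ R → IsWeakBisim R × R M N

-- [v, w]_g = { v + h·10^{-g} ≤ w : h ∈ ℕ }
grid : ℚ → ℚ → ℕ → List ℚ
grid v w g = map (λ h → v + (+ h / (10 ℕ.^ g)) {{m^n≢0 10 g}})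
                 (upTo (suc ∣ floor ((w - v) * (+ (10 ℕ.^ g) / 1)) ∣))

uniform : {A : Set} → List A → Dist A
uniform [] = []
uniform (x ∷ xs) = map (λ y → (+ 1 / suc (length xs)) , y) (x ∷ xs)

δ err : ℚ
δ = + 2 / 5
err = + 1 / 10

shifted : ℚ → ℚ → ℚ → ℕ → Dist ℚ
shifted t v₁ v₂ g = dmap (λ v → t + v) (uniform (grid v₁ v₂ g))

invG : ℚ → Bool
invG t = does (0ℚ ≤? t) ∧ does (t ≤? (+ 30 / 1))

-- c = ξ_a(cool); any value other than on is treated as off
evolG : ℕ → ℚ → Val → Dist ℚ
evolG g t on = shifted t (- 1ℚ - δ) (- 1ℚ + δ) g
evolG g t _  = shifted t (1ℚ - δ) (1ℚ + δ) g

evolHat : ℕ → ℚ → Val → Dist ℚ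
evolHat g t on = shifted t (- (+ 7 / 10) - δ) (- (+ 7 / 10) + δ) g
evolHat g t _  = shifted t (1ℚ - δ) (1ℚ + δ) g

measG : ℕ → ℚ → Dist ℚ
measG g t = shifted t (- err) err g

Env-g : ℕ → Env
Env-g g = record { evol = evolG g ; meas = measG g ; inv = invG }

EnvHat-g : ℕ → Env
EnvHat-g g = record { evol = evolHat g ; meas = measG g ; inv = invG }

S-g : PState
S-g = ⟨ 0ℚ , 0ℚ , off ⟩

-- names: process variables X = 0, Y = 1, Z = 2; value variable x = 0
ticks : ℕ → Proc → Proc
ticks zero P = P
ticks (suc k) P = tickP ((1ℚ , ticks k P) ∷ [])

-- c!v.P  =  fix Z. ⌊c!v.P⌋ Z
send : Chan → Val → Proc → Proc
send c v P = fix 2 (timeout (snd c (val v)) ((1ℚ , P) ∷ []) ((1ℚ , pvar 2) ∷ []))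

one : Proc → Choice
one P = (1ℚ , P) ∷ []

ten : Exp
ten = val (num (+ 10 / 1))

Cooling : Proc
Cooling = phy (wr cool (val on)) (one (fix 1 (ticks 5 body)))
  where
  body : Proc
  body = phy (rd s-t 0) (one (ite (gt (var 0) ten)
                                  (send warning ID (pvar 1))
                                  (phy (wr cool (val off)) (one (tickP (one (pvar 0)))))))

Ctrl : Proc
Ctrl = fix 0 (phy (rd s-t 0) (one (ite (gt (var 0) ten) Cooling (tickP (one (pvar 0))))))

Eng : ℕ → Sys
Eng g = cps (Env-g g) S-g Ctrl

EngHat : ℕ → Sys
EngHat g = cps (EnvHat-g g) S-g Ctrl

module Submission where

-- The engine with weak cooling can, with positive probability,
-- still read more than 10 after five ticks of cooling and then output a
-- warning; the engine with normal cooling never can.  Bisimilarity must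
-- match the weak engine's run step by step, so we follow that run through
-- an arbitrary weak bisimulation and reach a related pair in which the weak
-- engine outputs and its partner cannot.
--
-- Distributions are identified only up to equal expectations, so properties
-- transfer between them (and across matchings) only when they are
-- decidable; both the invariant of the normal engine and the description of
-- the weak engine's run therefore mention the environment only through
-- finitely many decidable agreements.

open import Defs
open import Data.Nat using (ℕ)
open import Relation.Nullary using (¬_; Dec)
open import Data.Product using (_,_; proj₁)

module Grid where

  open import Data.Nat as ℕ using (ℕ; suc; s≤s; NonZero)
  import Data.Nat.Properties as ℕP
  import Data.Nat.DivMod as ℕD
  import Data.Nat.Coprimality as Coprimality
  open import Data.Integer as ℤ using (+_; ∣_∣)
  import Data.Integer.Properties as ℤP
  open import Data.Rational using (ℚ; 0ℚ; _+_; _-_; _*_; _/_; _≤_; floor; toℚᵘ)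
  import Data.Rational.Properties as ℚP
  import Data.Rational.Unnormalised as ℚᵘ
  import Data.Rational.Unnormalised.Properties as ℚᵘP
  open import Data.List using (map; upTo)
  open import Data.List.Relation.Unary.All as All using (All)
  import Data.List.Relation.Unary.All.Properties as AllP
  open import Data.List.Membership.Propositional using (_∈_)
  open import Data.List.Membership.Propositional.Properties using (∈-map⁺; ∈-upTo⁺; ∈-upTo⁻)
  open import Algebra.Properties.AbelianGroup ℚP.+-0-abelianGroup using (xyx⁻¹≈y)
  open import Relation.Binary.PropositionalEquality
  open import Data.Nat.Solver using (module +-*-Solver)
  open +-*-Solver using (solve; _:*_; _:=_; con)

  toℚᵘ-/ : ∀ i d → toℚᵘ (i / suc d) ℚᵘ.≃ ℚᵘ.mkℚᵘ i d
  toℚᵘ-/ i d = ℚP.toℚᵘ-fromℚᵘ (ℚᵘ.mkℚᵘ i d)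

  /-≡ : ∀ i d j e → i ℤ.* + suc e ≡ j ℤ.* + suc d → i / suc d ≡ j / suc e
  /-≡ i d j e cross = ℚP.toℚᵘ-injective
    (ℚᵘP.≃-trans (toℚᵘ-/ i d) (ℚᵘP.≃-trans (ℚᵘ.*≡* cross) (ℚᵘP.≃-sym (toℚᵘ-/ j e))))

  /-monoˡ-≤ : ∀ {h k} d → h ℕ.≤ k → + h / suc d ≤ + k / suc d
  /-monoˡ-≤ {h} {k} d h≤k = ℚP.toℚᵘ-cancel-≤
    (ℚᵘP.≤-respʳ-≃ (ℚᵘP.≃-sym (toℚᵘ-/ (+ k) d)) (ℚᵘP.≤-respˡ-≃ (ℚᵘP.≃-sym (toℚᵘ-/ (+ h) d))
      (ℚᵘ.*≤* (ℤP.*-monoʳ-≤-nonNeg (+ suc d) (ℤ.+≤+ h≤k)))))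

  tenths : ∀ c m d → 10 ℕ.* m ≡ suc d → + (c ℕ.* m) / suc d ≡ + c / 10
  tenths c m d 10m≡d+1 = /-≡ (+ (c ℕ.* m)) d (+ c) 9 (begin
    + (c ℕ.* m) ℤ.* + 10     ≡⟨ sym (ℤP.pos-* (c ℕ.* m) 10) ⟩
    + (c ℕ.* m ℕ.* 10)       ≡⟨ cong +_ (solve 2 (λ c m → c :* m :* con 10 := c :* (con 10 :* m)) refl c m) ⟩
    + (c ℕ.* (10 ℕ.* m))     ≡⟨ cong (λ n → + (c ℕ.* n)) 10m≡d+1 ⟩
    + (c ℕ.* suc d)          ≡⟨ ℤP.pos-* c (suc d) ⟩
    + c ℤ.* + suc d          ∎)
    where open ≡-Reasoning

  floor-tenths : ∀ c m → floor ((+ c / 10) * (+ (10 ℕ.* m) / 1)) ≡ + (c ℕ.* m)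
  floor-tenths c m = begin
    floor ((+ c / 10) * (+ (10 ℕ.* m) / 1))   ≡⟨ cong floor product ⟩
    floor (+ (c ℕ.* m) / 1)                   ≡⟨ cong floor (ℚP.normalize-coprime {c ℕ.* m} {0} (Coprimality.sym (Coprimality.1-coprimeTo _))) ⟩
    + 1 ℤ.* + ((c ℕ.* m) ℕ./ 1)               ≡⟨ ℤP.*-identityˡ _ ⟩
    + ((c ℕ.* m) ℕ./ 1)                       ≡⟨ cong +_ (ℕD.n/1≡n (c ℕ.* m)) ⟩
    + (c ℕ.* m)                               ∎
    where
    open ≡-Reasoning
    product : (+ c / 10) * (+ (10 ℕ.* m) / 1) ≡ + (c ℕ.* m) / 1
    product = ℚP.toℚᵘ-injective
      (ℚᵘP.≃-trans (ℚP.toℚᵘ-homo-* (+ c / 10) (+ (10 ℕ.* m) / 1))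
      (ℚᵘP.≃-trans (ℚᵘP.*-cong (toℚᵘ-/ (+ c) 9) (toℚᵘ-/ (+ (10 ℕ.* m)) 0))
      (ℚᵘP.≃-trans (ℚᵘ.*≡* (begin
        (+ c ℤ.* + (10 ℕ.* m)) ℤ.* + 1   ≡⟨ cong (ℤ._* + 1) (sym (ℤP.pos-* c (10 ℕ.* m))) ⟩
        + (c ℕ.* (10 ℕ.* m)) ℤ.* + 1     ≡⟨ sym (ℤP.pos-* (c ℕ.* (10 ℕ.* m)) 1) ⟩
        + (c ℕ.* (10 ℕ.* m) ℕ.* 1)       ≡⟨ cong +_ (solve 2 (λ c m → c :* (con 10 :* m) :* con 1 := c :* m :* con 10) refl c m) ⟩
        + (c ℕ.* m ℕ.* 10)               ≡⟨ ℤP.pos-* (c ℕ.* m) 10 ⟩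
        + (c ℕ.* m) ℤ.* + 10             ∎))
      (ℚᵘP.≃-sym (toℚᵘ-/ (+ (c ℕ.* m)) 0)))))

  denom : ℕ → ℕ
  denom g' = ℕ.pred (10 ℕ.^ suc g')

  10^-suc : ∀ g' → 10 ℕ.* 10 ℕ.^ g' ≡ suc (denom g')
  10^-suc g' = lemma (10 ℕ.^ suc g') {{ℕP.m^n≢0 10 (suc g')}}
    where
    lemma : ∀ n .{{_ : NonZero n}} → n ≡ suc (ℕ.pred n)
    lemma (suc n) = refl

  -- The h-th grid point, with the same normalisation proof as in 'grid'.
  point : ℚ → ℕ → ℕ → ℚ
  point v g h = v + (+ h / (10 ℕ.^ g)) {{ℕP.m^n≢0 10 g}}

  point-denom : ∀ v g' h → point v (suc g') h ≡ v + + h / suc (denom g')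
  point-denom v g' h = cong (λ x → v + x)
    (ℚP./-cong {+ h} {{ℕP.m^n≢0 10 (suc g')}} refl (10^-suc g'))

  grid-points : ∀ v w c g' → v + + c / 10 ≡ w →
                grid v w (suc g') ≡ map (point v (suc g')) (upTo (suc (c ℕ.* 10 ℕ.^ g')))
  grid-points v w c g' refl =
    cong (λ n → map (point v (suc g')) (upTo (suc ∣ n ∣)))
      (trans (cong (λ x → floor (x * _)) (xyx⁻¹≈y v (+ c / 10))) (floor-tenths c (10 ℕ.^ g')))

  grid-lower : ∀ v w g → All (v ≤_) (grid v w g)
  grid-lower v w g = AllP.map⁺ (All.tabulate {xs = upTo (suc ∣ floor ((w - v) * (+ (10 ℕ.^ g) / 1)) ∣)} λ {h} _ → lower h)
    where
    open ℚP.≤-Reasoning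
    lower : ∀ h → v ≤ point v g h
    lower h = begin
      v            ≡⟨ sym (ℚP.+-identityʳ v) ⟩
      v + 0ℚ       ≤⟨ ℚP.+-monoʳ-≤ v (ℚP.nonNegative⁻¹ _ {{ℚP.normalize-nonNeg h (10 ℕ.^ g) {{ℕP.m^n≢0 10 g}}}}) ⟩
      point v g h  ∎

  grid-upper : ∀ v w c g' → v + + c / 10 ≡ w → All (_≤ w) (grid v w (suc g'))
  grid-upper v w c g' vw rewrite grid-points v w c g' vw =
    AllP.map⁺ (All.tabulate λ {h} h∈ → bound h (∈-upTo⁻ h∈))
    where
    bound : ∀ h → h ℕ.< suc (c ℕ.* 10 ℕ.^ g') → point v (suc g') h ≤ w
    bound h (s≤s h≤) = begin
      point v (suc g') h                     ≡⟨ point-denom v g' h ⟩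
      v + + h / suc (denom g')               ≤⟨ ℚP.+-monoʳ-≤ v (/-monoˡ-≤ (denom g') h≤) ⟩
      v + + (c ℕ.* 10 ℕ.^ g') / suc (denom g') ≡⟨ cong (λ x → v + x) (tenths c (10 ℕ.^ g') (denom g') (10^-suc g')) ⟩
      v + + c / 10                           ≡⟨ vw ⟩
      w                                      ∎
      where open ℚP.≤-Reasoning

  grid-member : ∀ v w c c' g' → v + + c / 10 ≡ w → c' ℕ.≤ c → v + + c' / 10 ∈ grid v w (suc g')
  grid-member v w c c' g' vw c'≤c rewrite grid-points v w c g' vw =
    subst (_∈ map (point v (suc g')) (upTo (suc (c ℕ.* 10 ℕ.^ g')))) tenth-point
      (∈-map⁺ (point v (suc g')) index)
    where
    index : c' ℕ.* 10 ℕ.^ g' ∈ upTo (suc (c ℕ.* 10 ℕ.^ g'))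
    index = ∈-upTo⁺ (s≤s (ℕP.*-monoˡ-≤ (10 ℕ.^ g') c'≤c))
    tenth-point : point v (suc g') (c' ℕ.* 10 ℕ.^ g') ≡ v + + c' / 10
    tenth-point = trans (point-denom v g' (c' ℕ.* 10 ℕ.^ g')) (cong (λ x → v + x) (tenths c' (10 ℕ.^ g') (denom g') (10^-suc g')))

-- A distribution is only known up to '≃' (equal
-- expectations), so facts about its points are transferred through the
-- mass 'mass Q? γ' that γ gives to a decidable predicate Q.
module Distributions where

  open import Data.Rational using (ℚ; 0ℚ; 1ℚ; _+_; _*_; _≤_; _<_; _/_; positive; nonNegative)
  import Data.Rational.Properties as ℚP
  open import Data.Integer using (+_)
  open import Data.Nat using (suc)
  open import Data.Product using (Σ; _×_; _,_; proj₁; proj₂)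
  open import Data.Bool using (if_then_else_)
  open import Data.List using (List; []; _∷_; length)
  open import Data.List.Relation.Unary.All as All using (All; []; _∷_)
  import Data.List.Relation.Unary.All.Properties as AllP
  open import Data.List.Relation.Unary.Any using (here; there)
  open import Data.List.Membership.Propositional using (_∈_)
  open import Data.List.Membership.Propositional.Properties using (∈-map⁺; ∈-concat⁺′)
  open import Relation.Nullary using (¬_; Dec; yes; no; does; contradiction)
  open import Relation.Nullary.Decidable using (¬?; decidable-stable)
  open import Relation.Binary.PropositionalEquality

  NonNegWeights : {A : Set} → Dist A → Set
  NonNegWeights γ = All (λ e → 0ℚ ≤ proj₁ e) γ

  PosWeights : {A : Set} → Dist A → Set
  PosWeights γ = All (λ e → 0ℚ < proj₁ e) γ

  *-pos : ∀ {p q} → 0ℚ < p → 0ℚ < q → 0ℚ < p * q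
  *-pos {p} {q} 0<p 0<q = ℚP.positive⁻¹ _ {{ℚP.pos*pos⇒pos p {{positive 0<p}} q {{positive 0<q}}}}

  *-nonNeg : ∀ {p q} → 0ℚ ≤ p → 0ℚ ≤ q → 0ℚ ≤ p * q
  *-nonNeg {p} {q} 0≤p 0≤q =
    ℚP.nonNegative⁻¹ _ {{ℚP.nonNeg*nonNeg⇒nonNeg p {{nonNegative 0≤p}} q {{nonNegative 0≤q}}}}

  0<1 : 0ℚ < 1ℚ
  0<1 = ℚP.positive⁻¹ 1ℚ

  Possible : {A : Set} → A → Dist A → Set
  Possible x γ = Σ ℚ λ p → 0ℚ < p × (p , x) ∈ γ

  Witness : {A : Set} → (A → Set) → Dist A → Set
  Witness {A} Q γ = Σ A λ x → Possible x γ × Q x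

  indicator : {A : Set} {Q : A → Set} → (∀ x → Dec (Q x)) → A → ℚ
  indicator Q? x = if does (Q? x) then 1ℚ else 0ℚ

  mass : {A : Set} {Q : A → Set} → (∀ x → Dec (Q x)) → Dist A → ℚ
  mass Q? γ = expect γ (indicator Q?)

  indicator-nonNeg : {A : Set} {Q : A → Set} (Q? : ∀ x → Dec (Q x)) → ∀ x → 0ℚ ≤ indicator Q? x
  indicator-nonNeg Q? x with Q? x
  ... | yes _ = ℚP.<⇒≤ 0<1
  ... | no _  = ℚP.≤-refl

  indicator-no : {A : Set} {Q : A → Set} (Q? : ∀ x → Dec (Q x)) → ∀ {x} → ¬ Q x → indicator Q? x ≡ 0ℚ
  indicator-no Q? {x} ¬Qx with Q? x
  ... | yes Qx = contradiction Qx ¬Qx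
  ... | no _ = refl

  mass-nonNeg : {A : Set} {Q : A → Set} (Q? : ∀ x → Dec (Q x)) {γ : Dist A} →
                NonNegWeights γ → 0ℚ ≤ mass Q? γ
  mass-nonNeg Q? [] = ℚP.≤-refl
  mass-nonNeg Q? {(p , x) ∷ γ} (0≤p ∷ ws) =
    ℚP.+-mono-≤ (*-nonNeg 0≤p (indicator-nonNeg Q? x)) (mass-nonNeg Q? ws)

  mass-zero : {A : Set} {Q : A → Set} (Q? : ∀ x → Dec (Q x)) (γ : Dist A) →
              All (λ e → ¬ Q (proj₂ e)) γ → mass Q? γ ≡ 0ℚ
  mass-zero Q? [] [] = refl
  mass-zero Q? ((p , x) ∷ γ) (¬Qx ∷ rest) =
    cong₂ _+_ (trans (cong (p *_) (indicator-no Q? ¬Qx)) (ℚP.*-zeroʳ p)) (mass-zero Q? γ rest)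

  mass-pos : {A : Set} {Q : A → Set} (Q? : ∀ x → Dec (Q x)) {γ : Dist A} → NonNegWeights γ →
             ∀ {p x} → (p , x) ∈ γ → 0ℚ < p → Q x → 0ℚ < mass Q? γ
  mass-pos Q? {(p , x) ∷ γ} (_ ∷ ws) (here refl) 0<p Qx with Q? x
  ... | no ¬Qx = contradiction Qx ¬Qx
  ... | yes _ rewrite ℚP.*-identityʳ p = ℚP.+-mono-<-≤ 0<p (mass-nonNeg Q? ws)
  mass-pos Q? {(p , x) ∷ γ} (0≤p ∷ ws) (there x∈) 0<p Qx =
    ℚP.+-mono-≤-< (*-nonNeg 0≤p (indicator-nonNeg Q? x)) (mass-pos Q? ws x∈ 0<p Qx)

  mass-pos⇒ : {A : Set} {Q : A → Set} (Q? : ∀ x → Dec (Q x)) {γ : Dist A} → NonNegWeights γ →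
              0ℚ < mass Q? γ → Witness Q γ
  mass-pos⇒ Q? [] 0<0 = contradiction 0<0 (ℚP.<-irrefl refl)
  mass-pos⇒ {Q = Q} Q? {(p , x) ∷ γ} (0≤p ∷ ws) 0<m = head-or-tail (0ℚ ℚP.<? p) (Q? x)
    where
    there-witness : Witness Q γ → Witness Q ((p , x) ∷ γ)
    there-witness (y , (q , 0<q , y∈) , Qy) = y , (q , 0<q , there y∈) , Qy
    tail : p * indicator Q? x ≡ 0ℚ → Witness Q ((p , x) ∷ γ)
    tail head≡0 = there-witness (mass-pos⇒ Q? ws
      (subst (0ℚ <_) (trans (cong (_+ mass Q? γ) head≡0) (ℚP.+-identityˡ _)) 0<m))
    head-or-tail : Dec (0ℚ < p) → Dec (Q x) → Witness Q ((p , x) ∷ γ)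
    head-or-tail (yes 0<p) (yes Qx) = x , (p , 0<p , here refl) , Qx
    head-or-tail (yes _) (no ¬Qx) = tail (trans (cong (p *_) (indicator-no Q? ¬Qx)) (ℚP.*-zeroʳ p))
    head-or-tail (no 0≮p) _ =
      tail (trans (cong (_* indicator Q? x) (ℚP.≤-antisym (ℚP.≮⇒≥ 0≮p) 0≤p)) (ℚP.*-zeroˡ (indicator Q? x)))

  expect-dmap : {A B : Set} (h : A → B) (γ : Dist A) (f : B → ℚ) →
                expect (dmap h γ) f ≡ expect γ (λ x → f (h x))
  expect-dmap h [] f = refl
  expect-dmap h (e ∷ γ) f = cong (λ r → proj₁ e * f (h (proj₂ e)) + r) (expect-dmap h γ f)

  ≃-support : {A : Set} {Q : A → Set} (Q? : ∀ x → Dec (Q x)) {γ₀ γ : Dist A} →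
              NonNegWeights γ₀ → γ₀ ≃ γ → All (λ e → Q (proj₂ e)) γ →
              ∀ {p x} → (p , x) ∈ γ₀ → 0ℚ < p → Q x
  ≃-support Q? {γ₀} {γ} ws γ₀≃γ allQ x∈ 0<p = decidable-stable (Q? _) λ ¬Qx →
    ℚP.<-irrefl (sym (trans (γ₀≃γ (indicator ¬Q?)) (mass-zero ¬Q? γ (All.map (λ Qy ¬Qy → ¬Qy Qy) allQ))))
                (mass-pos ¬Q? ws x∈ 0<p ¬Qx)
    where
    ¬Q? = λ y → ¬? (Q? y)

  matching-left : {Q : Sys → Set} (Q? : ∀ x → Dec (Q x)) {ω : Dist (Sys × Sys)} {γ γ' : Dist Sys} →
                  Matching ω γ γ' → NonNegWeights γ → ∀ {p M} → (p , M) ∈ γ → 0ℚ < p → Q M →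
                  Witness (λ e → Q (proj₁ e)) ω
  matching-left Q? {ω} (ω≥0 , left , _) ws M∈ 0<p QM =
    mass-pos⇒ (λ e → Q? (proj₁ e)) ω≥0
      (subst (0ℚ <_) (trans (sym (left (indicator Q?))) (expect-dmap proj₁ ω (indicator Q?)))
             (mass-pos Q? ws M∈ 0<p QM))

  matching-right : {Q : Sys → Set} (Q? : ∀ x → Dec (Q x)) {ω : Dist (Sys × Sys)} {γ γ' : Dist Sys} →
                   Matching ω γ γ' → All (λ e → Q (proj₂ e)) γ' →
                   ∀ {q M N} → (q , (M , N)) ∈ ω → 0ℚ < q → Q N
  matching-right Q? (ω≥0 , _ , right) allQ pair∈ 0<q =
    ≃-support Q? (AllP.map⁺ ω≥0) right allQ (∈-map⁺ (λ e → proj₁ e , proj₂ (proj₂ e)) pair∈) 0<q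

  uniform-pos : {A : Set} (xs : List A) → PosWeights (uniform xs)
  uniform-pos [] = []
  uniform-pos (x ∷ xs) = AllP.map⁺ (All.tabulate λ _ → ℚP.positive⁻¹ _ {{ℚP.normalize-pos 1 (suc (length xs))}})

  uniform-points : {A : Set} {Q : A → Set} {xs : List A} → All Q xs → All (λ e → Q (proj₂ e)) (uniform xs)
  uniform-points [] = []
  uniform-points all@(_ ∷ _) = AllP.map⁺ all

  uniform-member : {A : Set} {x : A} {xs : List A} → x ∈ xs → Possible x (uniform xs)
  uniform-member {xs = y ∷ ys} x∈ =
    _ , ℚP.positive⁻¹ _ {{ℚP.normalize-pos 1 (suc (length ys))}} , ∈-map⁺ (λ z → + 1 / suc (length ys) , z) x∈

  next-All : (E : Env) (S : PState) {R : ℚ × PState → Set} →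
             All (λ e → All (λ e' → R (proj₁ e * proj₁ e' , ⟨ proj₂ e , proj₂ e' , act S ⟩))
                            (meas E (proj₂ e)))
                 (evol E (temp S) (act S)) →
             All R (next E S)
  next-All E S all = AllP.concat⁺ (AllP.map⁺ (All.map AllP.map⁺ all))

  next-member : (E : Env) (S : PState) {p t' q s' : ℚ} → (p , t') ∈ evol E (temp S) (act S) →
                (q , s') ∈ meas E t' → (p * q , ⟨ t' , s' , act S ⟩) ∈ next E S
  next-member E S t'∈ s'∈ = ∈-concat⁺′ (∈-map⁺ _ s'∈) (∈-map⁺ _ t'∈)

  dprod-one-All : {A C : Set} {R : ℚ × C → Set} (f : A → Proc → C) {γ : Dist A} (P : Proc) →
                  All (λ e → R (proj₁ e * 1ℚ , f (proj₂ e) P)) γ → All R (dprod f γ (one P))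
  dprod-one-All f P all = AllP.concat⁺ (AllP.map⁺ (All.map (_∷ []) all))

  dprod-one-member : {A C : Set} (f : A → Proc → C) {γ : Dist A} {p : ℚ} {x : A} (P : Proc) →
                     (p , x) ∈ γ → (p * 1ℚ , f x P) ∈ dprod f γ (one P)
  dprod-one-member f P x∈ = ∈-concat⁺′ (here refl) (∈-map⁺ _ x∈)

-- Decidable equality of the syntax and of physical states: the invariants
-- below must be decidable predicates on systems (see 'Distributions'), and
-- they mention specific processes and states.
module Decidability where

  import Data.Nat.Properties as ℕP
  open import Data.Rational using (ℚ)
  import Data.Rational.Properties as ℚP
  open import Data.Product using (_,_)
  import Data.Product.Properties as ×P
  open import Data.List using ([]; _∷_)
  import Data.List.Properties as ListP
  open import Relation.Nullary using (yes; no)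
  open import Relation.Binary.PropositionalEquality using (refl)
  open import Relation.Binary.Definitions using (DecidableEquality)

  ≟-Val : DecidableEquality Val
  ≟-Val (num a) (num b) with a ℚP.≟ b
  ... | yes refl = yes refl
  ... | no a≢b = no λ { refl → a≢b refl }
  ≟-Val on on = yes refl
  ≟-Val off off = yes refl
  ≟-Val ID ID = yes refl
  ≟-Val (num _) on = no λ ()
  ≟-Val (num _) off = no λ ()
  ≟-Val (num _) ID = no λ ()
  ≟-Val on (num _) = no λ ()
  ≟-Val on off = no λ ()
  ≟-Val on ID = no λ ()
  ≟-Val off (num _) = no λ ()
  ≟-Val off on = no λ ()
  ≟-Val off ID = no λ ()
  ≟-Val ID (num _) = no λ ()
  ≟-Val ID on = no λ ()
  ≟-Val ID off = no λ ()

  ≟-Exp : DecidableEquality Exp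
  ≟-Exp (val a) (val b) with ≟-Val a b
  ... | yes refl = yes refl
  ... | no a≢b = no λ { refl → a≢b refl }
  ≟-Exp (var x) (var y) with x ℕP.≟ y
  ... | yes refl = yes refl
  ... | no x≢y = no λ { refl → x≢y refl }
  ≟-Exp (val _) (var _) = no λ ()
  ≟-Exp (var _) (val _) = no λ ()

  ≟-BExp : DecidableEquality BExp
  ≟-BExp (gt a b) (gt c d) with ≟-Exp a c | ≟-Exp b d
  ... | yes refl | yes refl = yes refl
  ... | no a≢c | _ = no λ { refl → a≢c refl }
  ... | _ | no b≢d = no λ { refl → b≢d refl }

  ≟-ChnPref : DecidableEquality ChnPref
  ≟-ChnPref (snd warning a) (snd warning b) with ≟-Exp a b
  ... | yes refl = yes refl
  ... | no a≢b = no λ { refl → a≢b refl }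
  ≟-ChnPref (rcv warning x) (rcv warning y) with x ℕP.≟ y
  ... | yes refl = yes refl
  ... | no x≢y = no λ { refl → x≢y refl }
  ≟-ChnPref (snd _ _) (rcv _ _) = no λ ()
  ≟-ChnPref (rcv _ _) (snd _ _) = no λ ()

  ≟-PhyPref : DecidableEquality PhyPref
  ≟-PhyPref (rd s-t x) (rd s-t y) with x ℕP.≟ y
  ... | yes refl = yes refl
  ... | no x≢y = no λ { refl → x≢y refl }
  ≟-PhyPref (wr cool a) (wr cool b) with ≟-Exp a b
  ... | yes refl = yes refl
  ... | no a≢b = no λ { refl → a≢b refl }
  ≟-PhyPref (rd _ _) (wr _ _) = no λ ()
  ≟-PhyPref (wr _ _) (rd _ _) = no λ ()

  mutual
    ≟-Proc : DecidableEquality Proc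
    ≟-Proc nil nil = yes refl
    ≟-Proc (tickP C) (tickP D) with ≟-Choice C D
    ... | yes refl = yes refl
    ... | no C≢D = no λ { refl → C≢D refl }
    ≟-Proc (P ∥ Q) (P' ∥ Q') with ≟-Proc P P' | ≟-Proc Q Q'
    ... | yes refl | yes refl = yes refl
    ... | no P≢P' | _ = no λ { refl → P≢P' refl }
    ... | _ | no Q≢Q' = no λ { refl → Q≢Q' refl }
    ≟-Proc (timeout π C D) (timeout π' C' D') with ≟-ChnPref π π' | ≟-Choice C C' | ≟-Choice D D'
    ... | yes refl | yes refl | yes refl = yes refl
    ... | no π≢π' | _ | _ = no λ { refl → π≢π' refl }
    ... | _ | no C≢C' | _ = no λ { refl → C≢C' refl }
    ... | _ | _ | no D≢D' = no λ { refl → D≢D' refl }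
    ≟-Proc (phy π C) (phy π' C') with ≟-PhyPref π π' | ≟-Choice C C'
    ... | yes refl | yes refl = yes refl
    ... | no π≢π' | _ = no λ { refl → π≢π' refl }
    ... | _ | no C≢C' = no λ { refl → C≢C' refl }
    ≟-Proc (ite b P Q) (ite b' P' Q') with ≟-BExp b b' | ≟-Proc P P' | ≟-Proc Q Q'
    ... | yes refl | yes refl | yes refl = yes refl
    ... | no b≢b' | _ | _ = no λ { refl → b≢b' refl }
    ... | _ | no P≢P' | _ = no λ { refl → P≢P' refl }
    ... | _ | _ | no Q≢Q' = no λ { refl → Q≢Q' refl }
    ≟-Proc (restr P warning) (restr P' warning) with ≟-Proc P P'
    ... | yes refl = yes refl
    ... | no P≢P' = no λ { refl → P≢P' refl }
    ≟-Proc (pvar X) (pvar Y) with X ℕP.≟ Y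
    ... | yes refl = yes refl
    ... | no X≢Y = no λ { refl → X≢Y refl }
    ≟-Proc (fix X P) (fix Y Q) with X ℕP.≟ Y | ≟-Proc P Q
    ... | yes refl | yes refl = yes refl
    ... | no X≢Y | _ = no λ { refl → X≢Y refl }
    ... | _ | no P≢Q = no λ { refl → P≢Q refl }
    ≟-Proc nil (tickP _) = no λ ()
    ≟-Proc nil (_ ∥ _) = no λ ()
    ≟-Proc nil (timeout _ _ _) = no λ ()
    ≟-Proc nil (phy _ _) = no λ ()
    ≟-Proc nil (ite _ _ _) = no λ ()
    ≟-Proc nil (restr _ _) = no λ ()
    ≟-Proc nil (pvar _) = no λ ()
    ≟-Proc nil (fix _ _) = no λ ()
    ≟-Proc (tickP _) nil = no λ ()
    ≟-Proc (tickP _) (_ ∥ _) = no λ ()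
    ≟-Proc (tickP _) (timeout _ _ _) = no λ ()
    ≟-Proc (tickP _) (phy _ _) = no λ ()
    ≟-Proc (tickP _) (ite _ _ _) = no λ ()
    ≟-Proc (tickP _) (restr _ _) = no λ ()
    ≟-Proc (tickP _) (pvar _) = no λ ()
    ≟-Proc (tickP _) (fix _ _) = no λ ()
    ≟-Proc (_ ∥ _) nil = no λ ()
    ≟-Proc (_ ∥ _) (tickP _) = no λ ()
    ≟-Proc (_ ∥ _) (timeout _ _ _) = no λ ()
    ≟-Proc (_ ∥ _) (phy _ _) = no λ ()
    ≟-Proc (_ ∥ _) (ite _ _ _) = no λ ()
    ≟-Proc (_ ∥ _) (restr _ _) = no λ ()
    ≟-Proc (_ ∥ _) (pvar _) = no λ ()
    ≟-Proc (_ ∥ _) (fix _ _) = no λ ()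
    ≟-Proc (timeout _ _ _) nil = no λ ()
    ≟-Proc (timeout _ _ _) (tickP _) = no λ ()
    ≟-Proc (timeout _ _ _) (_ ∥ _) = no λ ()
    ≟-Proc (timeout _ _ _) (phy _ _) = no λ ()
    ≟-Proc (timeout _ _ _) (ite _ _ _) = no λ ()
    ≟-Proc (timeout _ _ _) (restr _ _) = no λ ()
    ≟-Proc (timeout _ _ _) (pvar _) = no λ ()
    ≟-Proc (timeout _ _ _) (fix _ _) = no λ ()
    ≟-Proc (phy _ _) nil = no λ ()
    ≟-Proc (phy _ _) (tickP _) = no λ ()
    ≟-Proc (phy _ _) (_ ∥ _) = no λ ()
    ≟-Proc (phy _ _) (timeout _ _ _) = no λ ()
    ≟-Proc (phy _ _) (ite _ _ _) = no λ ()
    ≟-Proc (phy _ _) (restr _ _) = no λ ()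
    ≟-Proc (phy _ _) (pvar _) = no λ ()
    ≟-Proc (phy _ _) (fix _ _) = no λ ()
    ≟-Proc (ite _ _ _) nil = no λ ()
    ≟-Proc (ite _ _ _) (tickP _) = no λ ()
    ≟-Proc (ite _ _ _) (_ ∥ _) = no λ ()
    ≟-Proc (ite _ _ _) (timeout _ _ _) = no λ ()
    ≟-Proc (ite _ _ _) (phy _ _) = no λ ()
    ≟-Proc (ite _ _ _) (restr _ _) = no λ ()
    ≟-Proc (ite _ _ _) (pvar _) = no λ ()
    ≟-Proc (ite _ _ _) (fix _ _) = no λ ()
    ≟-Proc (restr _ _) nil = no λ ()
    ≟-Proc (restr _ _) (tickP _) = no λ ()
    ≟-Proc (restr _ _) (_ ∥ _) = no λ ()
    ≟-Proc (restr _ _) (timeout _ _ _) = no λ ()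
    ≟-Proc (restr _ _) (phy _ _) = no λ ()
    ≟-Proc (restr _ _) (ite _ _ _) = no λ ()
    ≟-Proc (restr _ _) (pvar _) = no λ ()
    ≟-Proc (restr _ _) (fix _ _) = no λ ()
    ≟-Proc (pvar _) nil = no λ ()
    ≟-Proc (pvar _) (tickP _) = no λ ()
    ≟-Proc (pvar _) (_ ∥ _) = no λ ()
    ≟-Proc (pvar _) (timeout _ _ _) = no λ ()
    ≟-Proc (pvar _) (phy _ _) = no λ ()
    ≟-Proc (pvar _) (ite _ _ _) = no λ ()
    ≟-Proc (pvar _) (restr _ _) = no λ ()
    ≟-Proc (pvar _) (fix _ _) = no λ ()
    ≟-Proc (fix _ _) nil = no λ ()
    ≟-Proc (fix _ _) (tickP _) = no λ ()
    ≟-Proc (fix _ _) (_ ∥ _) = no λ ()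
    ≟-Proc (fix _ _) (timeout _ _ _) = no λ ()
    ≟-Proc (fix _ _) (phy _ _) = no λ ()
    ≟-Proc (fix _ _) (ite _ _ _) = no λ ()
    ≟-Proc (fix _ _) (restr _ _) = no λ ()
    ≟-Proc (fix _ _) (pvar _) = no λ ()

    ≟-Choice : DecidableEquality Choice
    ≟-Choice [] [] = yes refl
    ≟-Choice ((p , P) ∷ C) ((q , Q) ∷ D) with p ℚP.≟ q | ≟-Proc P Q | ≟-Choice C D
    ... | yes refl | yes refl | yes refl = yes refl
    ... | no p≢q | _ | _ = no λ { refl → p≢q refl }
    ... | _ | no P≢Q | _ = no λ { refl → P≢Q refl }
    ... | _ | _ | no C≢D = no λ { refl → C≢D refl }
    ≟-Choice [] (_ ∷ _) = no λ ()
    ≟-Choice (_ ∷ _) [] = no λ ()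

  ≟-PState : DecidableEquality PState
  ≟-PState ⟨ t , s , a ⟩ ⟨ t' , s' , a' ⟩ with t ℚP.≟ t' | s ℚP.≟ s' | ≟-Val a a'
  ... | yes refl | yes refl | yes refl = yes refl
  ... | no t≢t' | _ | _ = no λ { refl → t≢t' refl }
  ... | _ | no s≢s' | _ = no λ { refl → s≢s' refl }
  ... | _ | _ | no a≢a' = no λ { refl → a≢a' refl }

  ≟-Dist : DecidableEquality (Dist ℚ)
  ≟-Dist = ListP.≡-dec (×P.≡-dec ℚP._≟_ ℚP._≟_)

-- The controller's intermediate processes, named as they arise when Ctrl runs.
module Controller where

  open import Data.Rational using (ℚ)

  Pause : Proc
  Pause = tickP (one Ctrl)

  Decide : Proc
  Decide = ite (gt (var 0) ten) (substP 0 Ctrl Cooling) Pause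

  decide : ℚ → Proc
  decide s = substV 0 (num s) Decide

  CoolingBody : Proc
  CoolingBody = phy (rd s-t 0) (one (ite (gt (var 0) ten)
                                         (send warning ID (pvar 1))
                                         (phy (wr cool (val off)) (one (tickP (one (pvar 0)))))))

  CoolingLoop : Proc
  CoolingLoop = fix 1 (ticks 5 (substP 0 Ctrl CoolingBody))

  Verdict : Proc
  Verdict = ite (gt (var 0) ten) (send warning ID CoolingLoop) (phy (wr cool (val off)) (one Pause))

  verdict : ℚ → Proc
  verdict s = substV 0 (num s) Verdict

  Probe : Proc
  Probe = phy (rd s-t 0) (one Verdict)

-- This is the decidable fragment of "E = E'" that a
-- single tick depends on.
module Agreement where

  open import Data.Rational using (ℚ; _*_)
  open import Data.Product using (_×_; _,_; proj₁; proj₂)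
  open import Data.List using ([]; _∷_; _++_; map; concatMap)
  open import Data.List.Relation.Unary.All as All using (All; []; _∷_)
  open import Relation.Nullary.Decidable using (_×-dec_)
  open import Relation.Binary.PropositionalEquality
  open Decidability using (≟-Dist)

  EvolAgrees : Env → Env → ℚ → Val → Set
  EvolAgrees E E' t a = evol E t a ≡ evol E' t a × All (λ e → meas E (proj₂ e) ≡ meas E' (proj₂ e)) (evol E' t a)

  evolAgrees? : ∀ E E' t a → Dec (EvolAgrees E E' t a)
  evolAgrees? E E' t a = ≟-Dist _ _ ×-dec All.all? (λ e → ≟-Dist _ _) _

  evolAgrees-refl : ∀ E t a → EvolAgrees E E t a
  evolAgrees-refl E t a = refl , All.tabulate λ _ → refl

  next-agrees : ∀ E E' S → EvolAgrees E E' (temp S) (act S) → next E S ≡ next E' S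
  next-agrees E E' S (evol≡ , meas≡) rewrite evol≡ = go (evol E' (temp S) (act S)) meas≡
    where
    spread : ℚ × ℚ → Dist ℚ → Dist PState
    spread e = map (λ e' → proj₁ e * proj₁ e' , ⟨ proj₂ e , proj₂ e' , act S ⟩)
    go : ∀ xs → All (λ e → meas E (proj₂ e) ≡ meas E' (proj₂ e)) xs →
         concatMap (λ e → spread e (meas E (proj₂ e))) xs ≡ concatMap (λ e → spread e (meas E' (proj₂ e))) xs
    go [] [] = refl
    go (x ∷ xs) (meas≡ ∷ rest) = cong₂ _++_ (cong (spread x) meas≡) (go xs rest)

-- A family Good k of decidable predicates on systems,
-- where the grade k bounds the number of ticks for which the invariant is
-- guaranteed, is "preserved" when every move of a Good system leads to Good
-- systems (one grade lower after a tick) and no Good system communicates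
-- on a channel.
-- Such an invariant is then preserved by weak moves, and it lets us follow a
-- move of M with the weak answer of a bisimilar N.
module GradedInvariant (Good : ℕ → Sys → Set) (good? : ∀ k M → Dec (Good k M)) where

  open Distributions
  open import Data.Nat using (suc)
  import Data.Rational.Properties as ℚP
  open import Data.Product using (Σ; _×_; _,_; proj₂)
  open import Data.Empty using (⊥)
  open import Data.Bool using (true)
  open import Data.List using (_∷_; [])
  open import Data.List.Relation.Unary.All as All using (All; []; _∷_)
  import Data.List.Relation.Unary.All.Properties as AllP
  open import Relation.Binary.PropositionalEquality using (_≡_; refl)

  AllGood : ℕ → Dist Sys → Set
  AllGood k γ = All (λ e → Good k (proj₂ e)) γ

  Successors : ℕ → Lab → Dist Sys → Set
  Successors k τ γ = AllGood k γ
  Successors k tick γ = ∀ {k'} → k ≡ suc k' → AllGood k' γ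
  Successors k (out _ _) γ = ⊥
  Successors k (inp _ _) γ = ⊥

  Preserved : Set
  Preserved = ∀ {k M α γ} → Good k M → M ==[ α ]⇒ γ → Successors k α γ

  MovesInto : Sys → Lab → (Sys → Set) → Set
  MovesInto M α Q = Σ (Dist Sys) λ γ → M ==[ α ]⇒ γ × NonNegWeights γ × Witness Q γ

  Follows : (Sys → Sys → Set) → (Sys → Set) → ℕ → Set
  Follows R Q k = Σ Sys λ M → Σ Sys λ N → R M N × Q M × Good k N

  module WeakMoves (preserved : Preserved) where

    -- Lifting a single-system predicate through the decomposition of a
    -- distribution: only the (positive-weight) points of the canonical
    -- decomposition move.
    lift : ∀ {α γ₀ δ b k k'} → (∀ {M δ'} → Good k M → HatStep M α δ' → AllGood k' δ') →
           AllGood k γ₀ → LiftStep α γ₀ δ b → AllGood k' δ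
    lift step good lnil = []
    lift step (goodM ∷ good) (lmove M→δ rest) = AllP.++⁺ (AllP.map⁺ (step goodM M→δ)) (lift step good rest)
    lift step (_ ∷ good) (lstuck _ rest) = lift step good rest

    canonical-good : ∀ {k γ₀ γ} → Canonical γ₀ → γ₀ ≃ γ → AllGood k γ → AllGood k γ₀
    canonical-good {k} (_ , pos) γ₀≃γ good =
      All.tabulate λ e∈ → ≃-support (good? k) (All.map ℚP.<⇒≤ pos) γ₀≃γ good e∈ (All.lookup pos e∈)

    dstep-τ : ∀ {k γ δ} → AllGood k γ → DStep γ τ δ → AllGood k δ
    dstep-τ good (γ₀ , can , γ₀≃γ , l) = lift step (canonical-good can γ₀≃γ good) l
      where
      step : ∀ {k M δ'} → Good k M → HatStep M τ δ' → AllGood k δ'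
      step goodM (real M→δ') = preserved goodM M→δ'
      step goodM idle = goodM ∷ []

    dstep-tick : ∀ {k γ δ} → AllGood (suc k) γ → DStep γ tick δ → AllGood k δ
    dstep-tick good (γ₀ , can , γ₀≃γ , l) = lift step (canonical-good can γ₀≃γ good) l
      where
      step : ∀ {k M δ'} → Good (suc k) M → HatStep M tick δ' → AllGood k δ'
      step goodM (real M→δ') = preserved goodM M→δ' refl

    dstep-out : ∀ {k c v γ δ} → AllGood k γ → ¬ DStep γ (out c v) δ
    dstep-out good (γ₀ , can , γ₀≃γ , l) = stuck (canonical-good can γ₀≃γ good) l
      where
      stuck : ∀ {k c v γ₀ δ} → AllGood k γ₀ → ¬ LiftStep (out c v) γ₀ δ true
      stuck (goodM ∷ _) (lmove (real M→δ') _) = preserved goodM M→δ'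
      stuck (_ ∷ good) (lstuck _ rest) = stuck good rest

    τ-closure : ∀ {k γ ρ} → AllGood k γ → TauStar γ ρ → AllGood k ρ
    τ-closure good refl* = good
    τ-closure good (step* d rest) = τ-closure (dstep-τ good d) rest

    weak-τ : ∀ {k N γ'} → Good k N → Weak N τ γ' → AllGood k γ'
    weak-τ goodN w = τ-closure (goodN ∷ []) w

    weak-tick : ∀ {k N γ'} → Good (suc k) N → Weak N tick γ' → AllGood k γ'
    weak-tick goodN (_ , _ , before , d , after) = τ-closure (dstep-tick (τ-closure (goodN ∷ []) before) d) after

    weak-out : ∀ {k N c v γ'} → Good k N → ¬ Weak N (out c v) γ'
    weak-out goodN (_ , _ , before , d , _) = dstep-out (τ-closure (goodN ∷ []) before) d

    follow : ∀ {R M N α k} {Q : Sys → Set} → (∀ x → Dec (Q x)) → IsWeakBisim R → R M N →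
             (∀ {γ'} → Weak N α γ' → AllGood k γ') → MovesInto M α Q → Follows R Q k
    follow {k = k} Q? (_ , bisim) M~N weak-good (γ , M→γ , ws , (_ , (_ , 0<p , M'∈) , QM'))
      with bisim M~N M→γ
    ... | (γ' , N⇒γ' , ω , match , related) with matching-left Q? {γ = γ} {γ'} match ws M'∈ 0<p QM'
    ...   | ((M'' , N'') , (q , 0<q , pair∈) , QM'') =
      M'' , N'' , related pair∈ 0<q , QM'' , matching-right (good? k) {γ = γ} {γ'} match (weak-good N⇒γ') pair∈ 0<q

    unmatched-output : ∀ {R M N k c v γ} → IsWeakBisim R → R M N → Good k N → ¬ M ==[ out c v ]⇒ γ
    unmatched-output (_ , bisim) M~N goodN M→γ with bisim M~N M→γ
    ... | (_ , N⇒γ' , _) = weak-out goodN N⇒γ'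

module EngineDistributions (g' : ℕ) where

  open Grid
  open Distributions
  open import Data.Nat as ℕ using (suc)
  open import Data.Bool using (T)
  open import Data.Integer using (+_)
  open import Data.Rational using (ℚ; 0ℚ; 1ℚ; _+_; _-_; -_; _/_; _≤_; _<_; _≤ᵇ_)
  import Data.Rational.Properties as ℚP
  open import Data.Product using (_×_; _,_; proj₁; proj₂)
  open import Data.List.Relation.Unary.All as All using (All)
  import Data.List.Relation.Unary.All.Properties as AllP
  open import Data.List.Membership.Propositional using (_∈_)
  open import Data.List.Membership.Propositional.Properties using (∈-map⁺)
  open import Relation.Binary.PropositionalEquality using (_≡_; refl)

  g : ℕ
  g = suc g'

  closed-≤ : (p q : ℚ) → {T (p ≤ᵇ q)} → p ≤ q
  closed-≤ p q {p≤ᵇq} = ℚP.≤ᵇ⇒≤ p≤ᵇq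

  shifted-points : ∀ t v w c → v + + c / 10 ≡ w →
                   All (λ e → 0ℚ < proj₁ e × t + v ≤ proj₂ e × proj₂ e ≤ t + w) (shifted t v w g)
  shifted-points t v w c vw = AllP.map⁺ (All.zipWith
    (λ { (0<p , v≤x , x≤w) → 0<p , ℚP.+-monoʳ-≤ t v≤x , ℚP.+-monoʳ-≤ t x≤w })
    (uniform-pos (grid v w g) , uniform-points (All.zip (grid-lower v w g , grid-upper v w c g' vw))))

  shifted-pos : ∀ t v w → PosWeights (shifted t v w g)
  shifted-pos t v w = AllP.map⁺ (uniform-pos (grid v w g))

  shifted-member : ∀ t v w c c' → v + + c / 10 ≡ w → c' ℕ.≤ c →
                   Possible (t + (v + + c' / 10)) (shifted t v w g)
  shifted-member t v w c c' vw c'≤c =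
    proj₁ chosen , proj₁ (proj₂ chosen) , ∈-map⁺ (λ e → proj₁ e , t + proj₂ e) (proj₂ (proj₂ chosen))
    where
    chosen : Possible (v + + c' / 10) (uniform (grid v w g))
    chosen = uniform-member (grid-member v w c c' g' vw c'≤c)

  Near : ℚ → ℚ → Set
  Near t s = t - err ≤ s × s ≤ t + err

  measured : ∀ t → All (λ e → 0ℚ < proj₁ e × Near t (proj₂ e)) (measG g t)
  measured t = shifted-points t (- err) err 2 refl

  heating-bound : ∀ t → All (λ e → proj₂ e ≤ t + (1ℚ + δ)) (evolG g t off)
  heating-bound t = All.map (λ { (_ , _ , x≤) → x≤ }) (shifted-points t (1ℚ - δ) (1ℚ + δ) 8 refl)

  cooling-bound : ∀ t → All (λ e → proj₂ e ≤ t + (- 1ℚ + δ)) (evolG g t on)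
  cooling-bound t = All.map (λ { (_ , _ , x≤) → x≤ }) (shifted-points t (- 1ℚ - δ) (- 1ℚ + δ) 8 refl)

-- Its controller runs
-- through six phases; in each one the temperature is bounded so that, once
-- the cooler has worked for five ticks, the reading is at most 8.6 and the
-- warning branch is never taken.  Since the controller's behaviour depends
-- on the environment, the invariant also records that the environment
-- agrees with Env-g g along the next k ticks.
module NormalEngine (g' : ℕ) where

  open Distributions
  open Decidability
  open Agreement
  open Controller
  open EngineDistributions g'
  open import Data.Nat as ℕ using (zero; suc; s≤s)
  import Data.Nat.Properties as ℕP
  open import Data.Integer using (+_)
  open import Data.Rational using (ℚ; 0ℚ; 1ℚ; _+_; _-_; -_; _/_; _≤_; _<_)
  import Data.Rational.Properties as ℚP
  open import Data.Product using (_×_; _,_; proj₁; proj₂)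
  open import Data.Unit using (⊤; tt)
  open import Data.Empty using (⊥-elim)
  open import Data.Bool using (true; false)
  open import Data.Maybe using (just)
  import Data.Maybe.Properties as MaybeP
  open import Data.List using (List; _∷_; []; map; upTo)
  open import Data.List.Relation.Unary.All as All using (All; _∷_; [])
  open import Data.List.Relation.Unary.Any as Any using (Any; here; there; satisfied)
  open import Data.List.Membership.Propositional using (_∈_; lose)
  open import Data.List.Membership.Propositional.Properties using (∈-map⁺; ∈-upTo⁺)
  open import Relation.Nullary using (yes; no; does)
  open import Relation.Nullary.Decidable using (_×-dec_)
  open import Relation.Binary.PropositionalEquality

  E₀ : Env
  E₀ = Env-g g

  mutual
    AgreesFor : ℕ → Env → ℚ → Set
    AgreesFor zero E t = ⊤
    AgreesFor (suc k) E t = AgreesAfter k E t on × AgreesAfter k E t off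

    AgreesAfter : ℕ → Env → ℚ → Val → Set
    AgreesAfter k E t a = EvolAgrees E E₀ t a × All (λ e → AgreesFor k E (proj₂ e)) (evol E₀ t a)

  mutual
    agreesFor? : ∀ k E t → Dec (AgreesFor k E t)
    agreesFor? zero E t = yes tt
    agreesFor? (suc k) E t = agreesAfter? k E t on ×-dec agreesAfter? k E t off

    agreesAfter? : ∀ k E t a → Dec (AgreesAfter k E t a)
    agreesAfter? k E t a = evolAgrees? E E₀ t a ×-dec All.all? (λ e → agreesFor? k E (proj₂ e)) _

  agreesFor-refl : ∀ k t → AgreesFor k E₀ t
  agreesFor-refl zero t = tt
  agreesFor-refl (suc k) t = after on , after off
    where
    after : ∀ a → AgreesAfter k E₀ t a
    after a = evolAgrees-refl E₀ t a , All.tabulate λ _ → agreesFor-refl k _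

  threshold : ℚ
  threshold = + 10 / 1

  -- Temperature bound while j ticks of the cooling loop remain.
  ceiling : ℕ → ℚ
  ceiling 0 = + 17 / 2
  ceiling 1 = + 91 / 10
  ceiling 2 = + 97 / 10
  ceiling 3 = + 103 / 10
  ceiling _ = + 109 / 10

  ceiling-step : ∀ j → j ℕ.< 4 → ceiling (suc j) + (- 1ℚ + δ) ≡ ceiling j
  ceiling-step 0 _ = refl
  ceiling-step 1 _ = refl
  ceiling-step 2 _ = refl
  ceiling-step 3 _ = refl
  ceiling-step (suc (suc (suc (suc _)))) (s≤s (s≤s (s≤s (s≤s ()))))

  data Phase : Set where
    polling deciding switchedOn verdicting pausing : Phase
    cooling : ℕ → Phase

  At : Phase → PState → Proc → Set
  At polling     S P = P ≡ Ctrl × act S ≡ off × temp S ≤ + 23 / 2 × Near (temp S) (sens S)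
  At deciding    S P = P ≡ decide (sens S) × act S ≡ off × temp S ≤ + 23 / 2 × Near (temp S) (sens S)
  At switchedOn  S P = P ≡ CoolingLoop × act S ≡ on × temp S ≤ + 23 / 2
  At (cooling j) S P = j ℕ.< 5 × P ≡ ticks j Probe × act S ≡ on × temp S ≤ ceiling j × Near (temp S) (sens S)
  At verdicting  S P = P ≡ verdict (sens S) × act S ≡ on × temp S ≤ + 17 / 2 × Near (temp S) (sens S)
  At pausing     S P = P ≡ Pause × act S ≡ off × temp S ≤ + 17 / 2

  near? : ∀ t s → Dec (Near t s)
  near? t s = (_ ℚP.≤? _) ×-dec (_ ℚP.≤? _)

  at? : ∀ ph S P → Dec (At ph S P)
  at? polling     S P = ≟-Proc P _ ×-dec ≟-Val (act S) off ×-dec _ ℚP.≤? _ ×-dec near? (temp S) (sens S)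
  at? deciding    S P = ≟-Proc P _ ×-dec ≟-Val (act S) off ×-dec _ ℚP.≤? _ ×-dec near? (temp S) (sens S)
  at? switchedOn  S P = ≟-Proc P _ ×-dec ≟-Val (act S) on ×-dec _ ℚP.≤? _
  at? (cooling j) S P = j ℕ.<? 5 ×-dec ≟-Proc P _ ×-dec ≟-Val (act S) on ×-dec _ ℚP.≤? _ ×-dec near? (temp S) (sens S)
  at? verdicting  S P = ≟-Proc P _ ×-dec ≟-Val (act S) on ×-dec _ ℚP.≤? _ ×-dec near? (temp S) (sens S)
  at? pausing     S P = ≟-Proc P _ ×-dec ≟-Val (act S) off ×-dec _ ℚP.≤? _

  phases : List Phase
  phases = polling ∷ deciding ∷ switchedOn ∷ verdicting ∷ pausing ∷ map cooling (upTo 5)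

  cooling∈ : ∀ {j} → j ℕ.< 5 → cooling j ∈ phases
  cooling∈ j<5 = there (there (there (there (there (∈-map⁺ cooling (∈-upTo⁺ j<5))))))

  Stage : PState → Proc → Set
  Stage S P = Any (λ ph → At ph S P) phases

  enter : ∀ {ph S P} → ph ∈ phases → At ph S P → Stage S P
  enter = lose

  polling∈ : polling ∈ phases
  polling∈ = here refl

  deciding∈ : deciding ∈ phases
  deciding∈ = there (here refl)

  switchedOn∈ : switchedOn ∈ phases
  switchedOn∈ = there (there (here refl))

  verdicting∈ : verdicting ∈ phases
  verdicting∈ = there (there (there (here refl)))

  pausing∈ : pausing ∈ phases
  pausing∈ = there (there (there (there (here refl))))

  Good : ℕ → Sys → Set
  Good k (cps E S P) = AgreesFor k E (temp S) × Stage S P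
  Good k Dead = ⊤

  good? : ∀ k M → Dec (Good k M)
  good? k (cps E S P) = agreesFor? k E (temp S) ×-dec Any.any? (λ ph → at? ph S P) phases
  good? k Dead = yes tt

  good-Eng : ∀ k → Good k (Eng (suc g'))
  good-Eng k = agreesFor-refl k 0ℚ , enter polling∈ (refl , refl , closed-≤ _ _ , closed-≤ _ _ , closed-≤ _ _)

  open GradedInvariant Good good? using (AllGood; Successors; Preserved)

  from-yes : {A : Set} (d : Dec A) → does d ≡ true → A
  from-yes (yes a) _ = a
  from-yes (no _) ()

  from-no : {A : Set} (d : Dec A) → does d ≡ false → ¬ A
  from-no (no ¬a) _ = ¬a
  from-no (yes _) ()

  guard-true : ∀ {s} → evalB (gt (val (num s)) ten) ≡ just true → threshold < s
  guard-true {s} holds = from-yes (threshold ℚP.<? s) (MaybeP.just-injective holds)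

  guard-false : ∀ {s} → evalB (gt (val (num s)) ten) ≡ just false → s ≤ threshold
  guard-false {s} fails = ℚP.≮⇒≥ (from-no (threshold ℚP.<? s) (MaybeP.just-injective fails))

  bound-step : ∀ {t t' c} d → t' ≤ t + d → t ≤ c → t' ≤ c + d
  bound-step d t'≤t+d t≤c = ℚP.≤-trans t'≤t+d (ℚP.+-monoˡ-≤ d t≤c)

  temp-below : ∀ {t s} → Near t s → t ≤ s + err
  temp-below {t} {s} (t-err≤s , _) = subst (_≤ s + err) undo (ℚP.+-monoˡ-≤ err t-err≤s)
    where
    undo : t - err + err ≡ t
    undo = trans (ℚP.+-assoc t (- err) err) (trans (cong (λ x → t + x) (ℚP.+-inverseˡ err)) (ℚP.+-identityʳ t))

  tick-good : ∀ {k E t s a P' u} → AgreesAfter k E t a →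
              All (λ e → proj₂ e ≤ u) (evol E₀ t a) →
              (∀ {t' s'} → t' ≤ u → Near t' s' → Stage ⟨ t' , s' , a ⟩ P') →
              AllGood k (dprod (cps E) (next E ⟨ t , s , a ⟩) (one P'))
  tick-good {k} {E} {t} {s} {a} {P'} (agree , later) bounded stage =
    subst (λ ν → AllGood k (dprod (cps E) ν (one P'))) (sym (next-agrees E E₀ S agree))
      (dprod-one-All {R = λ x → Good k (proj₂ x)} (cps E) P'
        (next-All E₀ S {R = λ x → Good k (cps E (proj₂ x) P')} successors))
    where
    S = ⟨ t , s , a ⟩
    successors : All (λ e → All (λ e' → Good k (cps E ⟨ proj₂ e , proj₂ e' , a ⟩ P')) (meas E₀ (proj₂ e)))
                     (evol E₀ t a)
    successors = All.zipWith
      (λ { {e} (agrees' , bound') → All.map (λ { (_ , near') → agrees' , stage bound' near' }) (measured (proj₂ e)) })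
      (later , bounded)

  from-polling : ∀ {k E t s α γ} → AgreesFor k E t → t ≤ + 23 / 2 → Near t s →
                 cps E ⟨ t , s , off ⟩ Ctrl ==[ α ]⇒ γ → Successors k α γ
  from-polling agrees t≤ near (cRead _ (rec read)) = (agrees , enter deciding∈ (refl , refl , t≤ , near)) ∷ []
  from-polling _ _ _ (cDead _) = tt ∷ []
  from-polling _ _ _ (cOut _ (rec ()))
  from-polling _ _ _ (cIn _ (rec ()))
  from-polling _ _ _ (cTau _ (rec ()))
  from-polling _ _ _ (cWrite _ (rec ()))
  from-polling _ _ _ (cTime _ (trec ()) _)

  -- Below the threshold the engine heats for one tick, ending below 10 + err + 1 + δ = 11.5.
  from-deciding : ∀ {k E t s α γ} → AgreesFor k E t → t ≤ + 23 / 2 → Near t s →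
                  cps E ⟨ t , s , off ⟩ (decide s) ==[ α ]⇒ γ → Successors k α γ
  from-deciding agrees t≤ near (cWrite _ (ifT _ write)) = (agrees , enter switchedOn∈ (refl , refl , t≤)) ∷ []
  from-deciding {t = t} {s = s} agrees t≤ near (cTime _ (tifF cold ttick) _) refl =
    tick-good {s = s} (proj₂ agrees) (heating-bound t) λ t'≤ near' →
      enter polling∈ (refl , refl , ℚP.≤-trans (bound-step (1ℚ + δ) t'≤ t≤10+err) (closed-≤ _ _) , near')
    where
    t≤10+err : t ≤ threshold + err
    t≤10+err = ℚP.≤-trans (temp-below near) (ℚP.+-monoˡ-≤ err (guard-false {s} cold))
  from-deciding _ _ _ (cDead _) = tt ∷ []
  from-deciding _ _ _ (cOut _ (ifT _ ()))
  from-deciding _ _ _ (cOut _ (ifF _ ()))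
  from-deciding _ _ _ (cIn _ (ifT _ ()))
  from-deciding _ _ _ (cIn _ (ifF _ ()))
  from-deciding _ _ _ (cTau _ (ifT _ ()))
  from-deciding _ _ _ (cTau _ (ifF _ ()))
  from-deciding _ _ _ (cRead _ (ifT _ ()))
  from-deciding _ _ _ (cRead _ (ifF _ ()))
  from-deciding _ _ _ (cWrite _ (ifF _ ()))
  from-deciding _ _ _ (cTime _ (tifT _ ()) _)

  from-switchedOn : ∀ {k E t s α γ} → AgreesFor k E t → t ≤ + 23 / 2 →
                    cps E ⟨ t , s , on ⟩ CoolingLoop ==[ α ]⇒ γ → Successors k α γ
  from-switchedOn {t = t} {s = s} agrees t≤ (cTime _ (trec ttick) _) refl =
    tick-good {s = s} (proj₁ agrees) (cooling-bound t) λ t'≤ near' →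
      enter (cooling∈ 4<5) (4<5 , refl , refl , bound-step (- 1ℚ + δ) t'≤ t≤ , near')
    where
    4<5 : 4 ℕ.< 5
    4<5 = ℕP.n<1+n 4
  from-switchedOn _ _ (cDead _) = tt ∷ []
  from-switchedOn _ _ (cOut _ (rec ()))
  from-switchedOn _ _ (cIn _ (rec ()))
  from-switchedOn _ _ (cTau _ (rec ()))
  from-switchedOn _ _ (cRead _ (rec ()))
  from-switchedOn _ _ (cWrite _ (rec ()))

  from-waiting : ∀ {k E t s α γ} j → suc j ℕ.< 5 → AgreesFor k E t → t ≤ ceiling (suc j) →
                 cps E ⟨ t , s , on ⟩ (ticks (suc j) Probe) ==[ α ]⇒ γ → Successors k α γ
  from-waiting {t = t} {s = s} j (s≤s j<4) agrees t≤ (cTime _ ttick _) refl =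
    tick-good {s = s} (proj₁ agrees) (cooling-bound t) λ t'≤ near' →
      enter (cooling∈ j<5) (j<5 , refl , refl , subst (_ ≤_) (ceiling-step j j<4) (bound-step (- 1ℚ + δ) t'≤ t≤) , near')
    where
    j<5 : j ℕ.< 5
    j<5 = ℕP.m<n⇒m<1+n j<4
  from-waiting _ _ _ _ (cDead _) = tt ∷ []
  from-waiting _ _ _ _ (cOut _ ())
  from-waiting _ _ _ _ (cIn _ ())
  from-waiting _ _ _ _ (cTau _ ())
  from-waiting _ _ _ _ (cRead _ ())
  from-waiting _ _ _ _ (cWrite _ ())

  from-probing : ∀ {k E t s α γ} → AgreesFor k E t → t ≤ ceiling 0 → Near t s →
                 cps E ⟨ t , s , on ⟩ Probe ==[ α ]⇒ γ → Successors k α γ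
  from-probing agrees t≤ near (cRead _ read) = (agrees , enter verdicting∈ (refl , refl , t≤ , near)) ∷ []
  from-probing _ _ _ (cDead _) = tt ∷ []
  from-probing _ _ _ (cOut _ ())
  from-probing _ _ _ (cIn _ ())
  from-probing _ _ _ (cTau _ ())
  from-probing _ _ _ (cWrite _ ())
  from-probing _ _ _ (cTime _ () _)

  -- The heart of the matter: after five ticks of normal cooling the reading
  -- is at most 8.5 + err < 10, so the warning branch is unreachable.
  from-verdicting : ∀ {k E t s α γ} → AgreesFor k E t → t ≤ + 17 / 2 → Near t s →
                    cps E ⟨ t , s , on ⟩ (verdict s) ==[ α ]⇒ γ → Successors k α γ
  from-verdicting {k} {E} {t} {s} agrees t≤ (_ , s≤t+err) = go
    where
    no-warning : ¬ evalB (gt (val (num s)) ten) ≡ just true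
    no-warning hot = ℚP.<-irrefl refl (ℚP.<-≤-trans (guard-true {s} hot)
      (ℚP.≤-trans s≤t+err (ℚP.≤-trans (ℚP.+-monoˡ-≤ err t≤) (closed-≤ _ _))))
    go : ∀ {α γ} → cps E ⟨ t , s , on ⟩ (verdict s) ==[ α ]⇒ γ → Successors k α γ
    go (cWrite _ (ifF _ write)) = (agrees , enter pausing∈ (refl , refl , t≤)) ∷ []
    go (cDead _) = tt ∷ []
    go (cOut _ (ifT hot _)) = no-warning hot
    go (cIn _ (ifT hot _)) = no-warning hot
    go (cTau _ (ifT hot _)) = ⊥-elim (no-warning hot)
    go (cRead _ (ifT hot _)) = ⊥-elim (no-warning hot)
    go (cWrite _ (ifT hot _)) = ⊥-elim (no-warning hot)
    go (cTime _ (tifT hot _) _) = ⊥-elim (no-warning hot)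
    go (cOut _ (ifF _ ()))
    go (cIn _ (ifF _ ()))
    go (cTau _ (ifF _ ()))
    go (cRead _ (ifF _ ()))
    go (cTime _ (tifF _ ()) _)

  from-pausing : ∀ {k E t s α γ} → AgreesFor k E t → t ≤ + 17 / 2 →
                 cps E ⟨ t , s , off ⟩ Pause ==[ α ]⇒ γ → Successors k α γ
  from-pausing {t = t} {s = s} agrees t≤ (cTime _ ttick _) refl =
    tick-good {s = s} (proj₂ agrees) (heating-bound t) λ t'≤ near' →
      enter polling∈ (refl , refl , ℚP.≤-trans (bound-step (1ℚ + δ) t'≤ t≤) (closed-≤ _ _) , near')
  from-pausing _ _ (cDead _) = tt ∷ []
  from-pausing _ _ (cOut _ ())
  from-pausing _ _ (cIn _ ())
  from-pausing _ _ (cTau _ ())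
  from-pausing _ _ (cRead _ ())
  from-pausing _ _ (cWrite _ ())

  from-phase : ∀ {k E t s a P α γ} ph → At ph ⟨ t , s , a ⟩ P → AgreesFor k E t →
               cps E ⟨ t , s , a ⟩ P ==[ α ]⇒ γ → Successors k α γ
  from-phase polling           (refl , refl , t≤ , near)     agrees = from-polling agrees t≤ near
  from-phase deciding          (refl , refl , t≤ , near)     agrees = from-deciding agrees t≤ near
  from-phase switchedOn        (refl , refl , t≤)            agrees = from-switchedOn agrees t≤
  from-phase (cooling zero)    (_ , refl , refl , t≤ , near) agrees = from-probing agrees t≤ near
  from-phase (cooling (suc j)) (j<5 , refl , refl , t≤ , _)  agrees = from-waiting j j<5 agrees t≤
  from-phase verdicting        (refl , refl , t≤ , near)     agrees = from-verdicting agrees t≤ near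
  from-phase pausing           (refl , refl , t≤)            agrees = from-pausing agrees t≤

  preserved : Preserved
  preserved {M = cps E S P} (agrees , stage) = from-phase (proj₁ (satisfied stage)) (proj₂ (satisfied stage)) agrees
  preserved {M = Dead} _ ()

-- The engine with weak cooling, along one run of positive probability: it
-- heats (readings 0.1 below the temperature) until the reading 11.4 at
-- temperature 11.5 switches the cooler on; the weak cooling may lower the
-- temperature by only 0.3 per tick, so after five ticks the reading is
-- 10.1 > 10 and the warning is raised.  A system reached along the run is
-- described up to its environment, which only has to agree with the
-- weak-cooling one at the temperatures visited (a decidable condition).
module WeakCoolingRun (g' : ℕ) where

  open Distributions
  open Decidability
  open Agreement
  open Controller
  open EngineDistributions g'
  open import Data.Nat as ℕ using (suc; z≤n)
  open import Data.Integer using (+_)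
  open import Data.Rational using (ℚ; 0ℚ; 1ℚ; _+_; _-_; _*_; -_; _/_; _≤_; _<_)
  import Data.Rational.Properties as ℚP
  open import Data.Product using (Σ; _×_; _,_; proj₁; proj₂)
  open import Data.Empty using (⊥)
  open import Data.Bool using (true; false)
  open import Data.Maybe using (just)
  open import Data.List using (List; []; _∷_)
  open import Data.List.Relation.Unary.All as All using (All; []; _∷_)
  open import Data.List.Relation.Unary.Any using (here)
  open import Data.List.Membership.Propositional using (_∈_)
  open import Relation.Nullary using (no)
  open import Relation.Nullary.Decidable using (_×-dec_; True; toWitness)
  open import Data.List.Membership.DecPropositional ℚP._≟_ using (_∈?_)
  open import Function using (_|>_)
  import Data.Nat.Properties as ℕP
  open import Relation.Binary.PropositionalEquality
  open NormalEngine g' using (Good; good?; preserved; good-Eng)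
  open GradedInvariant Good good? using (MovesInto; Follows)
  open GradedInvariant.WeakMoves Good good? preserved using (follow; weak-τ; weak-tick; unmatched-output)

  Ê : Env
  Ê = EnvHat-g g

  Temps : List ℚ
  Temps = + 0 / 1 ∷ + 1 / 1 ∷ + 2 / 1 ∷ + 3 / 1 ∷ + 4 / 1 ∷ + 5 / 1 ∷ + 6 / 1 ∷ + 7 / 1 ∷ + 8 / 1 ∷ + 9 / 1 ∷
          + 101 / 10 ∷ + 23 / 2 ∷ + 56 / 5 ∷ + 109 / 10 ∷ + 53 / 5 ∷ + 103 / 10 ∷ + 10 / 1 ∷ []

  AgreesAt : Env → ℚ → Set
  AgreesAt E t = inv E t ≡ inv Ê t × EvolAgrees E Ê t on × EvolAgrees E Ê t off

  InState : PState → Proc → Sys → Set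
  InState S P (cps E S' P') = S' ≡ S × P' ≡ P × All (AgreesAt E) Temps
  InState S P Dead = ⊥

  inState? : ∀ S P M → Dec (InState S P M)
  inState? S P (cps E S' P') =
    ≟-PState S' S ×-dec ≟-Proc P' P ×-dec
    All.all? (λ t → (inv E t Data.Bool.Properties.≟ inv Ê t) ×-dec evolAgrees? E Ê t on ×-dec evolAgrees? E Ê t off) Temps
    where import Data.Bool.Properties
  inState? S P Dead = no λ ()

  invariant-holds : ∀ {E t} → All (AgreesAt E) Temps → t ∈ Temps → invG t ≡ true → inv E t ≡ true
  invariant-holds agrees t∈ inv-t = trans (proj₁ (All.lookup agrees t∈)) inv-t

  certain : {Q : Sys → Set} {M : Sys} → Q M → Witness Q ((1ℚ , M) ∷ [])
  certain QM = _ , (1ℚ , 0<1 , here refl) , QM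

  read-move : ∀ {t s a x P P'} → t ∈ Temps → invG t ≡ true → P —[ prd s-t x ]→ one P' →
              ∀ M → InState ⟨ t , s , a ⟩ P M → MovesInto M τ (InState ⟨ t , s , a ⟩ (substV x (num s) P'))
  read-move t∈ inv-t P→ (cps E _ _) (refl , refl , agrees) =
    _ , cRead (invariant-holds {E} agrees t∈ inv-t) P→ , ℚP.<⇒≤ 0<1 ∷ [] , certain (refl , refl , agrees)

  write-move : ∀ {t s a v P P'} → t ∈ Temps → invG t ≡ true → P —[ pwr cool v ]→ one P' →
               ∀ M → InState ⟨ t , s , a ⟩ P M → MovesInto M τ (InState ⟨ t , s , v ⟩ P')
  write-move t∈ inv-t P→ (cps E _ _) (refl , refl , agrees) =
    _ , cWrite (invariant-holds {E} agrees t∈ inv-t) P→ , ℚP.<⇒≤ 0<1 ∷ [] , certain (refl , refl , agrees)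

  warn-move : ∀ {t s} → t ∈ Temps → invG t ≡ true → evalB (gt (val (num s)) ten) ≡ just true →
              ∀ M → InState ⟨ t , s , on ⟩ (verdict s) M → Σ (Dist Sys) λ γ → M ==[ out warning ID ]⇒ γ
  warn-move t∈ inv-t hot (cps E _ _) (refl , refl , agrees) =
    _ , cOut (invariant-holds {E} agrees t∈ inv-t) (ifT hot (rec out))

  tick-move : ∀ {t s a P P' t' s'} → t ∈ Temps → invG t ≡ true → (∀ {E} → AgreesAt E t → EvolAgrees E Ê t a) →
              P —tick→ one P' → ¬ (Σ (Dist Proc) λ π → P —[ pτ ]→ π) →
              PosWeights (evol Ê t a) → Possible t' (evol Ê t a) → Possible s' (meas Ê t') →
              ∀ M → InState ⟨ t , s , a ⟩ P M → MovesInto M tick (InState ⟨ t' , s' , a ⟩ P')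
  tick-move {t} {s} {a} {P} {P'} {t'} {s'} t∈ inv-t pick P→ no-τ evol-pos (p , 0<p , t'∈) (q , 0<q , s'∈)
            (cps E _ _) (refl , refl , agrees) =
    _ , cTime (invariant-holds {E} agrees t∈ inv-t) P→ no-τ ,
    subst (λ ν → NonNegWeights (dprod (cps E) ν (one P'))) (sym same-next) weights ,
    _ , (p * q * 1ℚ , *-pos (*-pos 0<p 0<q) 0<1 ,
         subst (λ ν → (p * q * 1ℚ , cps E ⟨ t' , s' , a ⟩ P') ∈ dprod (cps E) ν (one P')) (sym same-next)
               (dprod-one-member (cps E) P' (next-member Ê S t'∈ s'∈))) ,
    refl , refl , agrees
    where
    S = ⟨ t , s , a ⟩
    same-next : next E S ≡ next Ê S
    same-next = next-agrees E Ê S (pick {E} (All.lookup agrees t∈))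
    weights : NonNegWeights (dprod (cps E) (next Ê S) (one P'))
    weights = dprod-one-All {R = λ x → 0ℚ ≤ proj₁ x} (cps E) P'
      (next-All Ê S {R = λ x → 0ℚ ≤ proj₁ x * 1ℚ}
        (All.map (λ {e} 0<pₑ → All.map (λ { (0<qₑ , _) → *-nonNeg (*-nonNeg (ℚP.<⇒≤ 0<pₑ) (ℚP.<⇒≤ 0<qₑ)) (ℚP.<⇒≤ 0<1) })
                                        (measured (proj₂ e)))
                 evol-pos))

  heating-possible : ∀ t c → c ℕ.≤ 8 → Possible (t + ((1ℚ - δ) + + c / 10)) (evol Ê t off)
  heating-possible t c c≤8 = shifted-member t (1ℚ - δ) (1ℚ + δ) 8 c refl c≤8

  -- The weak cooling can lower the temperature by as little as 0.7 - δ = 0.3.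
  weak-cooling-possible : ∀ t → Possible (t + ((- (+ 7 / 10) - δ) + + 8 / 10)) (evol Ê t on)
  weak-cooling-possible t = shifted-member t (- (+ 7 / 10) - δ) (- (+ 7 / 10) + δ) 8 8 refl ℕP.≤-refl

  reading-possible : ∀ t c → c ℕ.≤ 2 → Possible (t + (- err + + c / 10)) (meas Ê t)
  reading-possible t c c≤2 = shifted-member t (- err) err 2 c refl c≤2

  module Run (R : Sys → Sys → Set) (bisim : IsWeakBisim R) (hat~eng : R (EngHat (suc g')) (Eng (suc g'))) where

    after-τ : ∀ {k S P S' P'} → (∀ M → InState S P M → MovesInto M τ (InState S' P')) →
              Follows R (InState S P) k → Follows R (InState S' P') k
    after-τ {S' = S'} {P'} move (M , N , M~N , M-in , goodN) =
      follow (inState? S' P') bisim M~N (weak-τ goodN) (move M M-in)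

    after-tick : ∀ {k S P S' P'} → (∀ M → InState S P M → MovesInto M tick (InState S' P')) →
                 Follows R (InState S P) (suc k) → Follows R (InState S' P') k
    after-tick {S' = S'} {P'} move (M , N , M~N , M-in , goodN) =
      follow (inState? S' P') bisim M~N (weak-tick goodN) (move M M-in)

    -- One round of the controller without cooling: the reading s ≤ 10 is
    -- taken, and the temperature rises by (1 - δ) + c/10, read err too low.
    warm : ∀ {k} t s t' s' c → t ∈ Temps → invG t ≡ true → evalB (gt (val (num s)) ten) ≡ just false →
           c ℕ.≤ 8 → t + ((1ℚ - δ) + + c / 10) ≡ t' → t' + (- err + + 0 / 10) ≡ s' →
           Follows R (InState ⟨ t , s , off ⟩ Ctrl) (suc k) → Follows R (InState ⟨ t' , s' , off ⟩ Ctrl) k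
    warm t s t' s' c t∈ inv-t cold c≤8 refl refl reached =
      after-tick (tick-move t∈ inv-t (λ agrees → proj₂ (proj₂ agrees)) (tifF cold ttick)
                            (λ { (_ , ifT _ ()) ; (_ , ifF _ ()) })
                            (shifted-pos t (1ℚ - δ) (1ℚ + δ)) (heating-possible t c c≤8) (reading-possible t' 0 z≤n))
        (after-τ (read-move t∈ inv-t (rec read)) reached)

    -- One tick of weak cooling: the temperature falls by 0.3, read c'/10 - err off.
    chill : ∀ {k P P'} t s t' s' c' → t ∈ Temps → invG t ≡ true → c' ℕ.≤ 2 →
           t + ((- (+ 7 / 10) - δ) + + 8 / 10) ≡ t' → t' + (- err + + c' / 10) ≡ s' →
           P —tick→ one P' → ¬ (Σ (Dist Proc) λ π → P —[ pτ ]→ π) →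
           Follows R (InState ⟨ t , s , on ⟩ P) (suc k) → Follows R (InState ⟨ t' , s' , on ⟩ P') k
    chill t s t' s' c' t∈ inv-t c'≤2 refl refl P→ no-τ =
      after-tick (tick-move t∈ inv-t (λ agrees → proj₁ (proj₂ agrees)) P→ no-τ
                            (shifted-pos t (- (+ 7 / 10) - δ) (- (+ 7 / 10) + δ))
                            (weak-cooling-possible t) (reading-possible t' c' c'≤2))

    visited : (t : ℚ) → {True (t ∈? Temps)} → t ∈ Temps
    visited t {t∈} = toWitness t∈

    start : Follows R (InState ⟨ 0ℚ , 0ℚ , off ⟩ Ctrl) 16
    start = EngHat (suc g') , Eng (suc g') , hat~eng ,
            (refl , refl , All.tabulate λ {t} _ → refl , evolAgrees-refl Ê t on , evolAgrees-refl Ê t off) ,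
            good-Eng 16

    -- Heating with readings 0.1 below the temperature: 0, 1, ..., 9, then
    -- 10.1 (read as 10.0, still no cooling), then 11.5 (read as 11.4).
    heated : Follows R (InState ⟨ + 23 / 2 , + 57 / 5 , off ⟩ Ctrl) 5
    heated = start
      |> warm 0ℚ          0ℚ          (+ 1 / 1)    (+ 9 / 10)  4 (visited _) refl refl (ℕP.≤ᵇ⇒≤ 4 8 _) refl refl
      |> warm (+ 1 / 1)   (+ 9 / 10)  (+ 2 / 1)    (+ 19 / 10) 4 (visited _) refl refl (ℕP.≤ᵇ⇒≤ 4 8 _) refl refl
      |> warm (+ 2 / 1)   (+ 19 / 10) (+ 3 / 1)    (+ 29 / 10) 4 (visited _) refl refl (ℕP.≤ᵇ⇒≤ 4 8 _) refl refl
      |> warm (+ 3 / 1)   (+ 29 / 10) (+ 4 / 1)    (+ 39 / 10) 4 (visited _) refl refl (ℕP.≤ᵇ⇒≤ 4 8 _) refl refl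
      |> warm (+ 4 / 1)   (+ 39 / 10) (+ 5 / 1)    (+ 49 / 10) 4 (visited _) refl refl (ℕP.≤ᵇ⇒≤ 4 8 _) refl refl
      |> warm (+ 5 / 1)   (+ 49 / 10) (+ 6 / 1)    (+ 59 / 10) 4 (visited _) refl refl (ℕP.≤ᵇ⇒≤ 4 8 _) refl refl
      |> warm (+ 6 / 1)   (+ 59 / 10) (+ 7 / 1)    (+ 69 / 10) 4 (visited _) refl refl (ℕP.≤ᵇ⇒≤ 4 8 _) refl refl
      |> warm (+ 7 / 1)   (+ 69 / 10) (+ 8 / 1)    (+ 79 / 10) 4 (visited _) refl refl (ℕP.≤ᵇ⇒≤ 4 8 _) refl refl
      |> warm (+ 8 / 1)   (+ 79 / 10) (+ 9 / 1)    (+ 89 / 10) 4 (visited _) refl refl (ℕP.≤ᵇ⇒≤ 4 8 _) refl refl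
      |> warm (+ 9 / 1)   (+ 89 / 10) (+ 101 / 10) (+ 10 / 1)  5 (visited _) refl refl (ℕP.≤ᵇ⇒≤ 5 8 _) refl refl
      |> warm (+ 101 / 10) (+ 10 / 1) (+ 23 / 2)   (+ 57 / 5)  8 (visited _) refl refl (ℕP.≤ᵇ⇒≤ 8 8 _) refl refl

    deciding : Follows R (InState ⟨ + 23 / 2 , + 57 / 5 , off ⟩ (decide (+ 57 / 5))) 5
    deciding = after-τ (read-move (visited _) refl (rec read)) heated

    switched-on : Follows R (InState ⟨ + 23 / 2 , + 57 / 5 , on ⟩ CoolingLoop) 5
    switched-on = after-τ (write-move (visited _) refl (ifT refl write)) deciding

    -- Five ticks of weak cooling bring the temperature to 10.0, read as 10.1.
    cooled : Follows R (InState ⟨ + 10 / 1 , + 101 / 10 , on ⟩ Probe) 0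
    cooled = switched-on
      |> chill (+ 23 / 2)   (+ 57 / 5)   (+ 56 / 5)   (+ 111 / 10) 0 (visited _) refl z≤n refl refl (trec ttick) (λ { (_ , rec ()) })
      |> chill (+ 56 / 5)   (+ 111 / 10) (+ 109 / 10) (+ 54 / 5)   0 (visited _) refl z≤n refl refl ttick (λ { (_ , ()) })
      |> chill (+ 109 / 10) (+ 54 / 5)   (+ 53 / 5)   (+ 21 / 2)   0 (visited _) refl z≤n refl refl ttick (λ { (_ , ()) })
      |> chill (+ 53 / 5)   (+ 21 / 2)   (+ 103 / 10) (+ 51 / 5)   0 (visited _) refl z≤n refl refl ttick (λ { (_ , ()) })
      |> chill (+ 103 / 10) (+ 51 / 5)   (+ 10 / 1)   (+ 101 / 10) 2 (visited _) refl (ℕP.≤ᵇ⇒≤ 2 2 _) refl refl ttick (λ { (_ , ()) })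

    warning-due : Follows R (InState ⟨ + 10 / 1 , + 101 / 10 , on ⟩ (verdict (+ 101 / 10))) 0
    warning-due = after-τ (read-move (visited _) refl read) cooled

    contradiction : ⊥
    contradiction = unanswered warning-due
      where
      unanswered : Follows R (InState ⟨ + 10 / 1 , + 101 / 10 , on ⟩ (verdict (+ 101 / 10))) 0 → ⊥
      unanswered (M , N , M~N , M-in , goodN) =
        unmatched-output bisim M~N goodN (proj₂ (warn-move (visited _) refl refl M M-in))

open import Data.Nat using (zero; suc; _≤_)

-- A weak bisimulation relating the two engines would let the normal engine
-- answer the warning raised along the weak-cooling run; its invariant
-- forbids that.
proposition4 : (g : ℕ) → 1 ≤ g → ¬ (Eng g ≈ EngHat g)
proposition4 zero ()
proposition4 (suc g') _ (R , bisim , eng~hat) =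
  WeakCoolingRun.Run.contradiction g' R bisim (proj₁ bisim eng~hat)
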